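{- Let $p$ be a prime, $q\in U^{(1)}$, $n\in\mathbb{N}$ ($n\geq 1$), and $m_0=v_p(q-1)$. If $p=3$ and $q\in U^{(1)}-U^{(2)}$, let $v_0$ be the smallest nonzero value of $v_3(z(z-1))$ over all modular fixed points $z\in\mathbb{Z}_3$ of $[\iota_q]_{3^n}$. If $q\equiv 1\pmod{p^n}$, then every point of $\mathbb{Z}_p$ is a modular fixed point of $[\iota_q]_{p^n}$. If $q\not\equiv 1\pmod{p^n}$, then the number of modular fixed points of $[\iota_q]_{p^n}$, counted modulo $p^n\mathbb{Z}_p$, is $$\begin{cases} 2p^{m_0} & \text{if $p$ is odd, and $p\neq 3$ or $q\in U^{(2)}$},\\ 2^{m_0} & \text{if } p=2,\\ 2\cdot 3^{v_0+1}+3 & \text{if $p=3$, $q\in U^{(1)}-U^{(2)}$, and $v_0<\frac{n-1}{2}$},\\ 3^{n-\lfloor n/2\rfloor}+3 & \text{if $p=3$, $q\in U^{(1)}-U^{(2)}$, and $v_0\geq\frac{n-1}{2}$.}\end{cases}$$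
   Context: $\mathbb{Z}_p$ is the ring of $p$-adic integers with additive valuation $v_p$, and $U^{(m)}=1+p^m\mathbb{Z}_p$. For $q\in U^{(1)}$, $\iota_q:\mathbb{Z}_p\to\mathbb{Z}_p$ is the unique continuous function with $\iota_q(k)=1+q+\cdots+q^{k-1}$ for all integers $k\ge 0$; thus $\iota_q(z)=(q^z-1)/(q-1)$ for $q\ne1$ and $\iota_1(z)=z$. $[\iota_q]_{p^n}$ is its reduction modulo $p^n$, and $z\in\mathbb{Z}_p$ is a modular fixed point of $[\iota_q]_{p^n}$ if $\iota_q(z)\equiv z\pmod{p^n}$; this property depends only on $z$ modulo $p^n$. -}

module Defs where

open import Level using (0ℓ)
open import Data.Nat.Base as ℕ using (ℕ; zero; suc; _^_; NonZero; _≤_)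
import Data.Nat.Properties as ℕ
open import Data.Nat.Primality using (Prime; prime⇒nonZero)
import Data.Nat.Divisibility as ℕ
open import Data.Integer.Base as ℤ using (ℤ; +_; 0ℤ; 1ℤ; ∣_∣; _%ℕ_; _/ℕ_)
import Data.Integer.Properties as ℤ
import Data.Integer.DivMod as ℤ
import Data.Integer.Divisibility.Signed as ℤ
open import Data.Integer.Solver using (module +-*-Solver)
open import Data.Fin.Base using (Fin; toℕ)
import Data.Fin.Properties as Fin
open import Data.Product.Base using (∃; _,_; _×_; proj₁)
open import Data.Sum.Base using (inj₁; inj₂)
open import Algebra.Bundles using (CommutativeRing)
import Algebra.Definitions.RawMagma as RawMagma
open import Function.Base using (_∘_)
open import Function.Bundles using (Bijection)
open import Relation.Binary.Bundles using (Setoid)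
open import Relation.Binary.Structures using (IsEquivalence)
import Relation.Binary.Construct.On as On
open import Relation.Binary.PropositionalEquality as ≡
  using (_≡_; _≢_; refl; cong; cong₂; subst; subst₂)

HasCardinality : Setoid 0ℓ 0ℓ → ℕ → Set
HasCardinality S N = Bijection (Fin.≡-setoid N) S

infix 4 _≡_[mod_]

record _≡_[mod_] (a b : ℤ) (m : ℕ) : Set where
  constructor mod
  field divides-difference : + m ℤ.∣ a ℤ.- b

open _≡_[mod_] public

module _ {m : ℕ} where

  open +-*-Solver

  abstract
    mod-reflexive : ∀ {a b} → a ≡ b → a ≡ b [mod m ]
    mod-reflexive {a} refl = mod (subst (+ m ℤ.∣_) (≡.sym (ℤ.+-inverseʳ a)) (ℤ.divides 0ℤ refl))

    mod-refl : ∀ {a} → a ≡ a [mod m ]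
    mod-refl = mod-reflexive refl

    mod-sym : ∀ {a b} → a ≡ b [mod m ] → b ≡ a [mod m ]
    mod-sym {a} {b} (mod d) = mod (subst (+ m ℤ.∣_)
      (solve 2 (λ a b → :- (a :- b) := b :- a) refl a b) (ℤ.∣m⇒∣-m d))

    mod-trans : ∀ {a b c} → a ≡ b [mod m ] → b ≡ c [mod m ] → a ≡ c [mod m ]
    mod-trans {a} {b} {c} (mod d) (mod e) = mod (subst (+ m ℤ.∣_)
      (solve 3 (λ a b c → (a :- b) :+ (b :- c) := a :- c) refl a b c) (ℤ.∣m∣n⇒∣m+n d e))

    mod-+ : ∀ {a b c d} → a ≡ b [mod m ] → c ≡ d [mod m ] → a ℤ.+ c ≡ b ℤ.+ d [mod m ]
    mod-+ {a} {b} {c} {d} (mod e) (mod f) = mod (subst (+ m ℤ.∣_)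
      (solve 4 (λ a b c d → (a :- b) :+ (c :- d) := (a :+ c) :- (b :+ d)) refl a b c d)
      (ℤ.∣m∣n⇒∣m+n e f))

    mod-neg : ∀ {a b} → a ≡ b [mod m ] → ℤ.- a ≡ ℤ.- b [mod m ]
    mod-neg {a} {b} (mod d) = mod (subst (+ m ℤ.∣_)
      (solve 2 (λ a b → :- (a :- b) := :- a :- :- b) refl a b) (ℤ.∣m⇒∣-m d))

    mod-* : ∀ {a b c d} → a ≡ b [mod m ] → c ≡ d [mod m ] → a ℤ.* c ≡ b ℤ.* d [mod m ]
    mod-* {a} {b} {c} {d} (mod e) (mod f) = mod (subst (+ m ℤ.∣_)
      (solve 4 (λ a b c d → a :* (c :- d) :+ d :* (a :- b) := a :* c :- b :* d) refl a b c d)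
      (ℤ.∣m∣n⇒∣m+n (ℤ.∣n⇒∣m*n a f) (ℤ.∣n⇒∣m*n d e)))

    mod-weaken : ∀ {k a b} → k ℕ.∣ m → a ≡ b [mod m ] → a ≡ b [mod k ]
    mod-weaken k∣m (mod d) = mod (ℤ.∣-trans (ℤ.∣ᵤ⇒∣ k∣m) d)

    mod-residue : ∀ a .{{_ : NonZero m}} → + (a %ℕ m) ≡ a [mod m ]
    mod-residue a = mod-sym (mod (subst (+ m ℤ.∣_)
      (≡.trans
        (solve 2 (λ r k → k := (r :+ k) :- r) refl (+ (a %ℕ m)) ((a /ℕ m) ℤ.* + m))
        (cong (ℤ._- + (a %ℕ m)) (≡.sym (ℤ.a≡a%ℕn+[a/ℕn]*n a m))))
      (ℤ.divides (a /ℕ m) refl)))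

module _ where

  open +-*-Solver

  geomℤ : ℤ → ℕ → ℤ
  geomℤ a zero    = 0ℤ
  geomℤ a (suc k) = 1ℤ ℤ.+ a ℤ.* geomℤ a k

  geomℤ-cong : ∀ {m a b} k → a ≡ b [mod m ] → geomℤ a k ≡ geomℤ b k [mod m ]
  geomℤ-cong zero    a≡b = mod-refl
  geomℤ-cong (suc k) a≡b = mod-+ (mod-refl {a = 1ℤ}) (mod-* a≡b (geomℤ-cong k a≡b))

  geomℤ-+ : ∀ a k l → geomℤ a (k ℕ.+ l) ≡ geomℤ a k ℤ.+ a ℤ.^ k ℤ.* geomℤ a l
  geomℤ-+ a zero    l = solve 1 (λ g → g := con 0ℤ :+ con 1ℤ :* g) refl (geomℤ a l)
  geomℤ-+ a (suc k) l = ≡.trans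
    (cong (λ g → 1ℤ ℤ.+ a ℤ.* g) (geomℤ-+ a k l))
    (solve 4 (λ a g x h → con 1ℤ :+ a :* (g :+ x :* h) := (con 1ℤ :+ a :* g) :+ (a :* x) :* h)
      refl a (geomℤ a k) (a ℤ.^ k) (geomℤ a l))

  geomℤ-* : ∀ a k l → geomℤ a (k ℕ.* l) ≡ geomℤ a l ℤ.* geomℤ (a ℤ.^ l) k
  geomℤ-* a zero    l = ≡.sym (ℤ.*-zeroʳ (geomℤ a l))
  geomℤ-* a (suc k) l = ≡.trans (geomℤ-+ a l (k ℕ.* l)) (≡.trans
    (cong (λ g → geomℤ a l ℤ.+ a ℤ.^ l ℤ.* g) (geomℤ-* a k l))
    (solve 3 (λ g x h → g :+ x :* (g :* h) := g :* (con 1ℤ :+ x :* h))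
      refl (geomℤ a l) (a ℤ.^ l) (geomℤ (a ℤ.^ l) k)))

  ^-≡1 : ∀ {m a} k → a ≡ 1ℤ [mod m ] → a ℤ.^ k ≡ 1ℤ [mod m ]
  ^-≡1 zero    a≡1 = mod-refl
  ^-≡1 (suc k) a≡1 = mod-* a≡1 (^-≡1 k a≡1)

  geomℤ-≡1 : ∀ {m a} k → a ≡ 1ℤ [mod m ] → geomℤ a k ≡ + k [mod m ]
  geomℤ-≡1 zero    a≡1 = mod-refl
  geomℤ-≡1 (suc k) a≡1 = mod-trans
    (mod-+ (mod-refl {a = 1ℤ}) (mod-* a≡1 (geomℤ-≡1 k a≡1)))
    (mod-reflexive (cong (λ g → 1ℤ ℤ.+ g) (ℤ.*-identityˡ (+ k))))

  p∣geomℤ : ∀ {p a} → a ≡ 1ℤ [mod p ] → + p ℤ.∣ geomℤ a p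
  p∣geomℤ {p} {a} a≡1 = subst (+ p ℤ.∣_)
    (solve 2 (λ g k → (g :- k) :+ k := g) refl (geomℤ a p) (+ p))
    (ℤ.∣m∣n⇒∣m+n (divides-difference (geomℤ-≡1 p a≡1)) ℤ.∣-refl)

  pⁿ∣geomℤ : ∀ {p a} n → a ≡ 1ℤ [mod p ] → + (p ^ n) ℤ.∣ geomℤ a (p ^ n)
  pⁿ∣geomℤ {p} {a} zero    a≡1 = ℤ.divides (geomℤ a 1) (≡.sym (ℤ.*-identityʳ (geomℤ a 1)))
  pⁿ∣geomℤ {p} {a} (suc n) a≡1 =
    subst₂ ℤ._∣_
      (≡.sym (ℤ.pos-* p (p ^ n)))
      (≡.sym (geomℤ-* a p (p ^ n)))
      (subst (ℤ._∣ (g ℤ.* h)) (ℤ.*-comm (+ (p ^ n)) (+ p))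
        (ℤ.∣-trans {j = g ℤ.* + p}
          (ℤ.*-monoˡ-∣ (+ p) {+ (p ^ n)} {g} (pⁿ∣geomℤ n a≡1))
          (ℤ.*-monoʳ-∣ g {+ p} {h} (p∣geomℤ (^-≡1 (p ^ n) a≡1)))))
    where
    g h : ℤ
    g = geomℤ a (p ^ n)
    h = geomℤ (a ℤ.^ (p ^ n)) p

  geomℤ-shift : ∀ {p a} n k d → a ≡ 1ℤ [mod p ] → p ^ n ℕ.∣ d →
                geomℤ a (k ℕ.+ d) ≡ geomℤ a k [mod p ^ n ]
  geomℤ-shift {p} {a} n k _ a≡1 (ℕ.divides j refl) = mod (subst (+ (p ^ n) ℤ.∣_)
    (≡.trans
      (solve 2 (λ g h → h := (g :+ h) :- g) refl (geomℤ a k) (a ℤ.^ k ℤ.* geomℤ a d))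
      (cong (ℤ._- geomℤ a k) (≡.sym (geomℤ-+ a k d))))
    (ℤ.∣n⇒∣m*n (a ℤ.^ k) (subst (+ (p ^ n) ℤ.∣_) (≡.sym (geomℤ-* a j (p ^ n)))
      (ℤ.∣m⇒∣m*n (geomℤ (a ℤ.^ (p ^ n)) j) (pⁿ∣geomℤ n a≡1)))))
    where d = j ℕ.* p ^ n

  geomℤ-ordered : ∀ {p a} n {k l} → a ≡ 1ℤ [mod p ] → k ≤ l → + l ≡ + k [mod p ^ n ] →
                  geomℤ a l ≡ geomℤ a k [mod p ^ n ]
  geomℤ-ordered {p} {a} n {k} {l} a≡1 k≤l (mod d) =
    subst (λ j → geomℤ a j ≡ geomℤ a k [mod p ^ n ]) (ℕ.m+[n∸m]≡n k≤l)
      (geomℤ-shift n k (l ℕ.∸ k) a≡1 (subst (p ^ n ℕ.∣_)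
        (cong ∣_∣ (≡.trans (ℤ.m-n≡m⊖n l k) (ℤ.⊖-≥ k≤l))) (ℤ.∣⇒∣ᵤ d)))

  geomℤ-cong-exponent : ∀ {p a} n k l → a ≡ 1ℤ [mod p ] → + k ≡ + l [mod p ^ n ] →
                        geomℤ a k ≡ geomℤ a l [mod p ^ n ]
  geomℤ-cong-exponent n k l a≡1 k≡l with ℕ.≤-total k l
  ... | inj₁ k≤l = mod-sym (geomℤ-ordered n a≡1 k≤l (mod-sym k≡l))
  ... | inj₂ l≤k = geomℤ-ordered n a≡1 l≤k k≡l

-- The p-adic integers as the inverse limit of the rings ℤ/pⁿ: an element is a
-- compatible family of residues, each given by an arbitrary integer
-- representative.
record ℤₚ (p : ℕ) : Set where
  no-eta-equality
  field
    approx   : ℕ → ℤ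
    coherent : ∀ n → approx (suc n) ≡ approx n [mod p ^ n ]

open ℤₚ public

module _ {p : ℕ} where

  infix 4 _≈_

  record _≈_ (x y : ℤₚ p) : Set where
    constructor equal
    field at : ∀ n → approx x n ≡ approx y n [mod p ^ n ]

  open _≈_ public

  infixl 6 _+ₚ_
  infixl 7 _*ₚ_

  fromℤ : ℤ → ℤₚ p
  fromℤ a .approx   n = a
  fromℤ a .coherent n = mod-refl

  _+ₚ_ _*ₚ_ : ℤₚ p → ℤₚ p → ℤₚ p
  (x +ₚ y) .approx   n = approx x n ℤ.+ approx y n
  (x +ₚ y) .coherent n = mod-+ (coherent x n) (coherent y n)
  (x *ₚ y) .approx   n = approx x n ℤ.* approx y n
  (x *ₚ y) .coherent n = mod-* (coherent x n) (coherent y n)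

  negₚ : ℤₚ p → ℤₚ p
  negₚ x .approx   n = ℤ.- approx x n
  negₚ x .coherent n = mod-neg (coherent x n)

  pointwise : ∀ {x y} → (∀ n → approx x n ≡ approx y n) → x ≈ y
  pointwise x≡y = equal λ n → mod-reflexive (x≡y n)

  ≈-isEquivalence : IsEquivalence _≈_
  ≈-isEquivalence = record
    { refl  = equal λ _ → mod-refl
    ; sym   = λ (equal x≈y) → equal λ n → mod-sym (x≈y n)
    ; trans = λ (equal x≈y) (equal y≈z) → equal λ n → mod-trans (x≈y n) (y≈z n)
    }

ℤₚ-commutativeRing : ℕ → CommutativeRing 0ℓ 0ℓ
ℤₚ-commutativeRing p = record
  { Carrier = ℤₚ p
  ; _≈_     = _≈_
  ; _+_     = _+ₚ_
  ; _*_     = _*ₚ_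
  ; -_      = negₚ
  ; 0#      = fromℤ 0ℤ
  ; 1#      = fromℤ 1ℤ
  ; isCommutativeRing = record
    { isRing = record
      { +-isAbelianGroup = record
        { isGroup = record
          { isMonoid = record
            { isSemigroup = record
              { isMagma = record
                { isEquivalence = ≈-isEquivalence
                ; ∙-cong = λ (equal e) (equal f) → equal λ n → mod-+ (e n) (f n)
                }
              ; assoc = λ x y z → pointwise λ n → ℤ.+-assoc (approx x n) (approx y n) (approx z n)
              }
            ; identity = (λ x → pointwise λ n → ℤ.+-identityˡ (approx x n))
                       , (λ x → pointwise λ n → ℤ.+-identityʳ (approx x n))
            }
          ; inverse = (λ x → pointwise λ n → ℤ.+-inverseˡ (approx x n))
                    , (λ x → pointwise λ n → ℤ.+-inverseʳ (approx x n))
          ; ⁻¹-cong = λ (equal e) → equal λ n → mod-neg (e n)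
          }
        ; comm = λ x y → pointwise λ n → ℤ.+-comm (approx x n) (approx y n)
        }
      ; *-cong = λ (equal e) (equal f) → equal λ n → mod-* (e n) (f n)
      ; *-assoc = λ x y z → pointwise λ n → ℤ.*-assoc (approx x n) (approx y n) (approx z n)
      ; *-identity = (λ x → pointwise λ n → ℤ.*-identityˡ (approx x n))
                   , (λ x → pointwise λ n → ℤ.*-identityʳ (approx x n))
      ; distrib = (λ x y z → pointwise λ n → ℤ.*-distribˡ-+ (approx x n) (approx y n) (approx z n))
                , (λ x y z → pointwise λ n → ℤ.*-distribʳ-+ (approx x n) (approx y n) (approx z n))
      }
    ; *-comm = λ x y → pointwise λ n → ℤ.*-comm (approx x n) (approx y n)
    }
  }

module _ {p : ℕ} where

  open CommutativeRing (ℤₚ-commutativeRing p) public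
    using (_+_; _*_; _-_; -_; 0#; 1#; semiring)

  open import Algebra.Properties.Semiring.Divisibility semiring public
    using (_∣_; _∤_)
  open import Algebra.Properties.Semiring.Exp semiring public
    using () renaming (_^_ to _^ₚ_)
  open import Algebra.Properties.Semiring.Sum semiring public
    using (sum; *-distribˡ-sum)

  infix 4 _≡_[mod-p^_] _∈U_

  p^_ : ℕ → ℤₚ p
  p^ n = fromℤ (+ (p ^ n))

  _≡_[mod-p^_] : ℤₚ p → ℤₚ p → ℕ → Set
  x ≡ y [mod-p^ n ] = p^ n ∣ x - y

  _∈U_ : ℤₚ p → ℕ → Set
  x ∈U m = x ≡ 1# [mod-p^ m ]

  -- HasValuation x v says that v_p(x) equals the natural number v; no v
  -- qualifies for x ≈ 0, whose valuation is infinite.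
  HasValuation : ℤₚ p → ℕ → Set
  HasValuation x v = p^ v ∣ x × p^ suc v ∤ x

  pᵏ∣pⁿ⁺ᵏ : ∀ n k → p ^ k ℕ.∣ p ^ (n ℕ.+ k)
  pᵏ∣pⁿ⁺ᵏ n k = ℕ.divides (p ^ n) (ℕ.^-distribˡ-+-* p n k)

  mod-pred : ∀ {a b} n → a ≡ b [mod p ^ suc n ] → a ≡ b [mod p ^ n ]
  mod-pred n = mod-weaken (pᵏ∣pⁿ⁺ᵏ 1 n)

  coherent-+ : ∀ x n k → approx x (n ℕ.+ k) ≡ approx x k [mod p ^ k ]
  coherent-+ x zero    k = mod-refl
  coherent-+ x (suc n) k = mod-trans
    (mod-weaken (pᵏ∣pⁿ⁺ᵏ n k) (coherent x (n ℕ.+ k)))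
    (coherent-+ x n k)

  mod-p^⇒approx : ∀ {x y} n → x ≡ y [mod-p^ n ] → approx x n ≡ approx y n [mod p ^ n ]
  mod-p^⇒approx n (w RawMagma., wpⁿ≈x-y) =
    mod (ℤ.∣m+n∣m⇒∣n
      (subst (+ (p ^ n) ℤ.∣_)
        (solve 2 (λ a b → a := (a :- b) :+ b) refl _ _)
        (ℤ.∣n⇒∣m*n (approx w n) ℤ.∣-refl))
      (divides-difference (at wpⁿ≈x-y n)))
    where open +-*-Solver

module _ {p : ℕ} {{p-prime : Prime p}} where

  private instance
    p≢0 : NonZero p
    p≢0 = prime⇒nonZero p-prime

  approx⇒mod-p^ : ∀ {x y : ℤₚ p} n → approx x n ≡ approx y n [mod p ^ n ] → x ≡ y [mod-p^ n ]
  approx⇒mod-p^ {x} {y} n (mod pⁿ∣zₙ) = w RawMagma., equal λ k →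
    mod-trans
      (mod-reflexive (≡.sym (ℤ._∣_.equality (quotients k))))
      (subst (λ j → approx z j ≡ approx z k [mod p ^ k ]) (ℕ.+-comm n k) (coherent-+ z n k))
    where
    open +-*-Solver

    z : ℤₚ p
    z = x - y

    quotients : ∀ k → + (p ^ n) ℤ.∣ approx z (k ℕ.+ n)
    quotients k = subst (+ (p ^ n) ℤ.∣_)
      (solve 2 (λ a b → (a :- b) :+ b := a) refl _ _)
      (ℤ.∣m∣n⇒∣m+n (divides-difference (coherent-+ z k n)) pⁿ∣zₙ)

    w : ℤₚ p
    w .approx   k = ℤ.quotient (quotients k)
    w .coherent k = mod (ℤ.*-cancelʳ-∣ (+ (p ^ n)) {{ℕ.m^n≢0 p n}}
          (subst₂ ℤ._∣_
            (≡.trans (cong +_ (ℕ.^-distribˡ-+-* p k n)) (ℤ.pos-* (p ^ k) (p ^ n)))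
            (≡.trans
              (cong₂ ℤ._-_ (ℤ._∣_.equality (quotients (suc k))) (ℤ._∣_.equality (quotients k)))
              (solve 3 (λ a b c → a :* c :- b :* c := (a :- b) :* c) refl
                (ℤ.quotient (quotients (suc k))) (ℤ.quotient (quotients k)) (+ (p ^ n))))
            (divides-difference (coherent z (k ℕ.+ n)))))

  geom : ℤₚ p → ℕ → ℤₚ p
  geom q k = sum {n = k} (λ i → q ^ₚ toℕ i)

  geom-approx : ∀ q k n → approx (geom q k) n ≡ geomℤ (approx q n) k [mod p ^ n ]
  geom-approx q zero    n = mod-refl
  geom-approx q (suc k) n = mod-+ (mod-refl {a = 1ℤ}) (mod-trans
    (mod-sym (at (*-distribˡ-sum {p} {k} q (λ i → q ^ₚ toℕ i)) n))
    (mod-* (mod-refl {a = approx q n}) (geom-approx q k n)))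

  ∈U⇒approx≡1 : ∀ {q : ℤₚ p} → q ∈U 1 → ∀ n → approx q (suc n) ≡ 1ℤ [mod p ]
  ∈U⇒approx≡1 {q} q∈U n = subst (approx q (suc n) ≡ 1ℤ [mod_]) (ℕ.*-identityʳ p)
    (mod-trans
      (subst (λ j → approx q j ≡ approx q 1 [mod p ^ 1 ]) (ℕ.+-comm n 1) (coherent-+ q n 1))
      (mod-p^⇒approx 1 q∈U))

  geom-periodic : ∀ {q : ℤₚ p} → q ∈U 1 → ∀ n {k l} → + k ≡ + l [mod p ^ n ] →
                  approx (geom q k) n ≡ approx (geom q l) n [mod p ^ n ]
  geom-periodic {q} q∈U n {k} {l} k≡l =
    mod-trans (mod-sym (coherent (geom q k) n))
    (mod-trans (mod-pred n (geom-approx q k (suc n)))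
    (mod-trans (geomℤ-cong-exponent n k l (∈U⇒approx≡1 q∈U n) k≡l)
    (mod-trans (mod-sym (mod-pred n (geom-approx q l (suc n))))
    (coherent (geom q l) n))))

  residue : ℤₚ p → ℕ → ℕ
  residue z n = _%ℕ_ (approx z n) (p ^ n) {{ℕ.m^n≢0 p n}}

  residue-≡ : ∀ z n → + residue z n ≡ approx z n [mod p ^ n ]
  residue-≡ z n = mod-residue (approx z n) {{ℕ.m^n≢0 p n}}

  -- For q ∈ U⁽¹⁾ the sum geom q k modulo pⁿ depends only on k modulo pⁿ, so
  -- ι_q(z) modulo pⁿ is geom q k for the residue k of z modulo pⁿ.  The lemmas
  -- ι-continuous, ι-ℕ and ι-unique show that this is the only continuous
  -- function with ι_q(k) = 1 + q + ⋯ + q^(k-1) for all natural numbers k.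
  ι : (q : ℤₚ p) → q ∈U 1 → ℤₚ p → ℤₚ p
  ι q q∈U z .approx   n = approx (geom q (residue z n)) n
  ι q q∈U z .coherent n = mod-trans
    (coherent (geom q (residue z (suc n))) n)
    (geom-periodic q∈U n
      (mod-trans (mod-pred n (residue-≡ z (suc n)))
      (mod-trans (coherent z n)
      (mod-sym (residue-≡ z n)))))

  Continuous : (ℤₚ p → ℤₚ p) → Set
  Continuous f = ∀ z n → ∃ λ m → ∀ w → w ≡ z [mod-p^ m ] → f w ≡ f z [mod-p^ n ]

  ι-mod : ∀ {q : ℤₚ p} (q∈U : q ∈U 1) n {w z} → w ≡ z [mod-p^ n ] → ι q q∈U w ≡ ι q q∈U z [mod-p^ n ]
  ι-mod q∈U n {w} {z} w≡z = approx⇒mod-p^ n (geom-periodic q∈U n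
    (mod-trans (residue-≡ w n)
    (mod-trans (mod-p^⇒approx n w≡z)
    (mod-sym (residue-≡ z n)))))

  ι-continuous : ∀ {q : ℤₚ p} (q∈U : q ∈U 1) → Continuous (ι q q∈U)
  ι-continuous q∈U z n = n , λ w → ι-mod q∈U n

  ι-ℕ : ∀ {q : ℤₚ p} (q∈U : q ∈U 1) k → ι q q∈U (fromℤ (+ k)) ≈ geom q k
  ι-ℕ q∈U k = equal λ n → geom-periodic q∈U n (residue-≡ (fromℤ (+ k)) n)

  ι-unique : ∀ {q : ℤₚ p} (q∈U : q ∈U 1) (f : ℤₚ p → ℤₚ p) → Continuous f →
             (∀ k → f (fromℤ (+ k)) ≈ geom q k) → ∀ z → f z ≈ ι q q∈U z
  ι-unique {q} q∈U f f-continuous f-ℕ z = equal λ n → at-level n (f-continuous z n)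
    where
    at-level : ∀ n → (∃ λ m → ∀ w → w ≡ z [mod-p^ m ] → f w ≡ f z [mod-p^ n ]) →
               approx (f z) n ≡ approx (ι q q∈U z) n [mod p ^ n ]
    at-level n (m , close) =
      mod-trans (mod-sym (mod-p^⇒approx n (close (fromℤ (+ k)) (approx⇒mod-p^ m k≡zₘ))))
      (mod-trans (at (f-ℕ k) n)
      (geom-periodic q∈U n (mod-trans k≡zₙ (mod-sym (residue-≡ z n)))))
      where
      k : ℕ
      k = residue z (n ℕ.+ m)

      k≡z : + k ≡ approx z (n ℕ.+ m) [mod p ^ (n ℕ.+ m) ]
      k≡z = residue-≡ z (n ℕ.+ m)

      k≡zₘ : + k ≡ approx z m [mod p ^ m ]
      k≡zₘ = mod-trans (mod-weaken (pᵏ∣pⁿ⁺ᵏ n m) k≡z) (coherent-+ z n m)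

      k≡zₙ : + k ≡ approx z n [mod p ^ n ]
      k≡zₙ = mod-trans
        (mod-weaken (subst (λ j → p ^ n ℕ.∣ p ^ j) (ℕ.+-comm m n) (pᵏ∣pⁿ⁺ᵏ m n)) k≡z)
        (subst (λ j → approx z j ≡ approx z n [mod p ^ n ]) (ℕ.+-comm m n) (coherent-+ z m n))

  ℤₚ/p^_ : ℕ → Setoid 0ℓ 0ℓ
  ℤₚ/p^ n = record
    { Carrier       = ℤₚ p
    ; _≈_           = λ x y → x ≡ y [mod-p^ n ]
    ; isEquivalence = record
      { refl  = approx⇒mod-p^ n mod-refl
      ; sym   = λ e → approx⇒mod-p^ n (mod-sym (mod-p^⇒approx n e))
      ; trans = λ e f → approx⇒mod-p^ n (mod-trans (mod-p^⇒approx n e) (mod-p^⇒approx n f))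
      }
    }

  module _ (q : ℤₚ p) (q∈U : q ∈U 1) (n : ℕ) where

    ModularFixedPoint : ℤₚ p → Set
    ModularFixedPoint z = ι q q∈U z ≡ z [mod-p^ n ]

    ModularFixedPoints : Setoid 0ℓ 0ℓ
    ModularFixedPoints = On.setoid {B = ∃ ModularFixedPoint} (ℤₚ/p^ n) proj₁

    -- Fixed points with z(z-1) = 0, of infinite valuation, do not matter here:
    -- z = pⁿ is a modular fixed point with z(z-1) of valuation n, so when n ≥ 1
    -- the smallest nonzero valuation is finite.
    IsSmallestNonzeroValuation : ℕ → Set
    IsSmallestNonzeroValuation v =
        v ≢ 0
      × (∃ λ z → ModularFixedPoint z × HasValuation (z * (z - 1#)) v)
      × (∀ z u → ModularFixedPoint z → HasValuation (z * (z - 1#)) u → u ≢ 0 → v ≤ u)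

-- Write q = 1 + d.  Then ι_q(k) - k = d · Σ_{j ≥ 2} C(k, j) d^(j-2), so for v_p(d) = m < n
-- a natural number k is a modular fixed point iff p^(n-m) divides the sum, half of the
-- "defect".  The term j = 2 doubled is k (k - 1).  Unless p = 3 and m = 1, all later terms
-- have larger valuation than k (k - 1), and the fixed points are two balls around 0 and 1.
--
-- If p = 3 and d = 3 u with u a unit, the term j = 3 counts as well: the defect is
-- k (k - 1) b(k) with b(k) ≡ 1 + u (k - 2) mod 3, so b has valuation 0 away from one
-- residue r ∈ {0, 1}.  On the residue class of r, b is an isometry up to a unit, because
-- 3^(j-2) / j! is divisible by 3 for j ≥ 4.  To avoid division this is expressed by
--   l (l - 1) defect k - k (k - 1) defect l ≈ u k (k - 1) l (l - 1) (k - l).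
-- The fixed points near r solve v(k - r) + v(b(k)) ≥ n - 1; they form two balls when the
-- zero of b is far enough from r, and one ball around r otherwise.  In the first case a
-- fixed point with minimal valuation serves as an approximation of the zero, in the second
-- an approximation is obtained by Newton iteration.
module Submission where

open import Data.Nat.Base as ℕ using (ℕ; zero; suc; z≤n; s≤s; _!)
import Data.Nat.Properties as ℕ
import Data.Nat.Divisibility as ℕ
import Data.Nat.DivMod as ℕ
open import Data.Nat.Combinatorics using (_C_; nCk+nC[k+1]≡[n+1]C[k+1]; nC1≡n; k>n⇒nCk≡0)
open import Data.Nat.Induction using (<-rec)
open import Data.Nat.Primality as ℕ using (Prime)
open import Data.Fin.Base as Fin using (Fin; toℕ)
import Data.Fin.Properties as Fin
import Data.Integer.Base as ℤ
import Data.Integer.Divisibility.Signed as ℤ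
import Data.Integer.DivMod as ℤ
import Data.Integer.Properties as ℤ
open import Data.Integer.Solver using (module +-*-Solver)
open import Data.Product.Base using (∃; _×_; _,_; proj₁; proj₂)
open import Data.Sum.Base using (_⊎_; inj₁; inj₂; [_,_])
import Algebra.Definitions.RawMagma as RawMagma
open import Function.Base using (_∘_)
open import Relation.Binary.PropositionalEquality
  using (_≡_; _≢_; refl; sym; trans; cong; cong₂; subst; subst₂)
open import Relation.Nullary using (¬_; yes; no; contradiction)
import Defs as D
open import Defs using (geomℤ; geomℤ-+; _≡_[mod_]; mod; divides-difference; mod-refl; mod-reflexive;
  mod-trans; mod-sym; ℤₚ; approx; fromℤ; equal; at; residue; residue-≡; _∈U_; HasValuation;
  HasCardinality; ModularFixedPoint; ModularFixedPoints; IsSmallestNonzeroValuation)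

-- Divisibility of integers by powers of a prime.

module PrimePowers {p : ℕ} (p-prime : Prime p) where

  open import Data.Integer.Base using (ℤ; +_; _+_; _*_; _-_; -_; 0ℤ; 1ℤ)
  open import Data.Integer.Divisibility.Signed
  open +-*-Solver

  instance
    p≢0 : ℕ.NonZero p
    p≢0 = ℕ.prime⇒nonZero p-prime

  p^ : ℕ → ℤ
  p^ a = + (p ℕ.^ a)

  p^-suc : ∀ a → p^ (suc a) ≡ + p * p^ a
  p^-suc a = ℤ.pos-* p (p ℕ.^ a)

  p^-+ : ∀ a b → p^ (a ℕ.+ b) ≡ p^ a * p^ b
  p^-+ a b = trans (cong +_ (ℕ.^-distribˡ-+-* p a b)) (ℤ.pos-* (p ℕ.^ a) (p ℕ.^ b))

  p^1 : p^ 1 ≡ + p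
  p^1 = cong +_ (ℕ.*-identityʳ p)

  p^-mono-∣ : ∀ {a b} → a ℕ.≤ b → p^ a ∣ p^ b
  p^-mono-∣ {a} {b} a≤b = divides (p^ (b ℕ.∸ a))
    (trans (cong p^ (sym (ℕ.m∸n+n≡m a≤b))) (p^-+ (b ℕ.∸ a) a))

  p^-weaken : ∀ {a b x} → a ℕ.≤ b → p^ b ∣ x → p^ a ∣ x
  p^-weaken a≤b = ∣-trans (p^-mono-∣ a≤b)

  p∣⇒p^1∣ : ∀ {x} → + p ∣ x → p^ 1 ∣ x
  p∣⇒p^1∣ {x} = subst (_∣ x) (sym p^1)

  p^1∣⇒p∣ : ∀ {x} → p^ 1 ∣ x → + p ∣ x
  p^1∣⇒p∣ {x} = subst (_∣ x) p^1

  p^suc∣⇒p∣ : ∀ {a x} → p^ (suc a) ∣ x → + p ∣ x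
  p^suc∣⇒p∣ {a} {x} d = p^1∣⇒p∣ (p^-weaken {1} {suc a} {x} (s≤s z≤n) d)

  *-pres-p^∣ : ∀ {a b x y} → p^ a ∣ x → p^ b ∣ y → p^ (a ℕ.+ b) ∣ x * y
  *-pres-p^∣ {a} {b} (divides s refl) (divides t refl) = divides (s * t) (trans
    (solve 4 (λ s t x y → (s :* x) :* (t :* y) := (s :* t) :* (x :* y)) refl s t (p^ a) (p^ b))
    (cong (s * t *_) (sym (p^-+ a b))))

  euclid : ∀ x y → + p ∣ x * y → + p ∣ x ⊎ + p ∣ y
  euclid x y p∣xy with ℕ.euclidsLemma ℤ.∣ x ∣ ℤ.∣ y ∣ p-prime (subst (p ℕ.∣_) (ℤ.abs-* x y) (∣⇒∣ᵤ p∣xy))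
  ... | inj₁ p∣x = inj₁ (∣ᵤ⇒∣ p∣x)
  ... | inj₂ p∣y = inj₂ (∣ᵤ⇒∣ p∣y)

  p∤1 : ¬ + p ∣ 1ℤ
  p∤1 p∣1 = ℕ.<⇒≱ (ℕ.nonTrivial⇒n>1 p {{ℕ.prime⇒nonTrivial p-prime}}) (ℕ.∣⇒≤ (∣⇒∣ᵤ p∣1))

  p∤* : ∀ {x y} → ¬ + p ∣ x → ¬ + p ∣ y → ¬ + p ∣ x * y
  p∤* {x} {y} p∤x p∤y d with euclid x y d
  ... | inj₁ p∣x = p∤x p∣x
  ... | inj₂ p∣y = p∤y p∣y

  p*-cancel-∣ : ∀ a x → p^ (suc a) ∣ x * + p → p^ a ∣ x
  p*-cancel-∣ a x d = *-cancelʳ-∣ (+ p) (subst (_∣ x * + p) (trans (p^-suc a) (ℤ.*-comm (+ p) (p^ a))) d)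

  p*-mono-∣ : ∀ a x → p^ a ∣ x → p^ (suc a) ∣ x * + p
  p*-mono-∣ a x d = subst (_∣ x * + p) (trans (ℤ.*-comm (p^ a) (+ p)) (sym (p^-suc a)))
    (*-monoˡ-∣ (+ p) {p^ a} {x} d)

  unit-cancel : ∀ b {x y} → ¬ + p ∣ x → p^ b ∣ x * y → p^ b ∣ y
  unit-cancel zero {y = y} p∤x d = divides y (sym (ℤ.*-identityʳ y))
  unit-cancel (suc b) {x} {y} p∤x d with euclid x y (p^suc∣⇒p∣ {b} d)
  ... | inj₁ p∣x = contradiction p∣x p∤x
  ... | inj₂ (divides y′ refl) = p*-mono-∣ b y′ (unit-cancel b p∤x
    (p*-cancel-∣ b (x * y′) (subst (p^ (suc b) ∣_) (sym (ℤ.*-assoc x y′ (+ p))) d)))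

  -- The factor x has valuation at most t - 1, so at least n + 1 is left for y. The induction strips
  -- one p from x at a time until x is a unit.
  ∤-cancel : ∀ t n {x y} → ¬ p^ t ∣ x → p^ (n ℕ.+ t) ∣ x * y → p^ (suc n) ∣ y
  ∤-cancel zero    n {x} p^t∤x d = contradiction (divides x (sym (ℤ.*-identityʳ x))) p^t∤x
  ∤-cancel (suc t) n {x} {y} p^t∤x d with + p ∣? x
  ... | no  p∤x = p^-weaken (subst (suc n ℕ.≤_) (sym (ℕ.+-suc n t)) (s≤s (ℕ.m≤m+n n t)))
                    (unit-cancel (n ℕ.+ suc t) p∤x d)
  ... | yes (divides x′ refl) = ∤-cancel t n (p^t∤x ∘ p*-mono-∣ t x′)
    (p*-cancel-∣ (n ℕ.+ t) (x′ * y) (subst₂ (λ a z → p^ a ∣ z) (ℕ.+-suc n t)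
      (solve 3 (λ x y p → (x :* p) :* y := (x :* y) :* p) refl x′ y (+ p)) d))

  infix 4 _∥_

  -- Exact valuation, the integer counterpart of `HasValuation`; 0 has none.
  _∥_ : ℕ → ℤ → Set
  a ∥ x = p^ a ∣ x × ¬ p^ (suc a) ∣ x

  ∥-cancel : ∀ {a x} b {y} → a ∥ x → p^ (a ℕ.+ b) ∣ x * y → p^ b ∣ y
  ∥-cancel     zero    {y} _         d = divides y (sym (ℤ.*-identityʳ y))
  ∥-cancel {a} {x} (suc b) {y} (_ , a+1∤x) d =
    ∤-cancel (suc a) b a+1∤x (subst (λ e → p^ e ∣ x * y) e d)
    where
    e : a ℕ.+ suc b ≡ b ℕ.+ suc a
    e = trans (ℕ.+-suc a b) (trans (cong suc (ℕ.+-comm a b)) (sym (ℕ.+-suc b a)))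

  ∥-unique-≤ : ∀ {a b x} → a ∥ x → p^ b ∣ x → b ℕ.≤ a
  ∥-unique-≤ {a} {b} (_ , a+1∤x) p^b∣x with b ℕ.≤? a
  ... | yes b≤a = b≤a
  ... | no  b≰a = contradiction (p^-weaken (ℕ.≰⇒> b≰a) p^b∣x) a+1∤x

  -- The search for the valuation is bounded by b, so that x = 0 needs no separate treatment.
  ∣⊎∥ : ∀ b x → p^ b ∣ x ⊎ ∃ λ a → a ℕ.< b × a ∥ x
  ∣⊎∥ zero    x = inj₁ (divides x (sym (ℤ.*-identityʳ x)))
  ∣⊎∥ (suc b) x with ∣⊎∥ b x | p^ (suc b) ∣? x
  ... | _                    | yes p^b+1∣x = inj₁ p^b+1∣x
  ... | inj₁ p^b∣x           | no  p^b+1∤x = inj₂ (b , ℕ.≤-refl , p^b∣x , p^b+1∤x)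
  ... | inj₂ (a , a<b , a∥x) | no  _       = inj₂ (a , ℕ.m≤n⇒m≤1+n a<b , a∥x)

  n<p^n : ∀ n → n ℕ.< p ℕ.^ n
  n<p^n zero    = s≤s z≤n
  n<p^n (suc n) = ℕ.≤-trans
    (ℕ.+-mono-≤ (ℕ.m^n>0 p n) (n<p^n n))
    (ℕ.≤-trans (ℕ.≤-reflexive (cong (p ℕ.^ n ℕ.+_) (sym (ℕ.+-identityʳ (p ℕ.^ n)))))
      (ℕ.*-monoˡ-≤ (p ℕ.^ n) (ℕ.nonTrivial⇒n>1 p {{ℕ.prime⇒nonTrivial p-prime}})))

  ∃-∥ : ∀ {x} → x ≢ 0ℤ → ∃ λ a → a ∥ x
  -- Searching up to |x| suffices, since |x| < p^|x| rules out the first alternative for nonzero x.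
  ∃-∥ {x} x≢0 with ∣⊎∥ ℤ.∣ x ∣ x
  ... | inj₂ (a , _ , a∥x) = a , a∥x
  ... | inj₁ d = contradiction (ℕ.∣⇒≤ {{ℕ.≢-nonZero (x≢0 ∘ ℤ.∣i∣≡0⇒i≡0)}} (∣⇒∣ᵤ d)) (ℕ.<⇒≱ (n<p^n ℤ.∣ x ∣))

  -- The factors cannot both be multiples of p, so one is prime to p and the other carries the whole
  -- power.
  split-product : ∀ e {a b} → ¬ + p ∣ a - b → p^ e ∣ a * b → p^ e ∣ a ⊎ p^ e ∣ b
  split-product e {a} {b} p∤a-b d with + p ∣? a
  ... | no  p∤a = inj₂ (unit-cancel e p∤a d)
  ... | yes p∣a = inj₁ (unit-cancel e (λ p∣b → p∤a-b (∣m∣n⇒∣m-n p∣a p∣b)) (subst (p^ e ∣_) (ℤ.*-comm a b) d))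

-- Binomial coefficients and the tails of the binomial expansion.

module IteratedSums where

  open import Data.Integer.Base using (ℤ; +_; _+_; _*_; _-_; -_; 0ℤ; 1ℤ; _^_)
  open import Data.Integer.Divisibility.Signed
  open +-*-Solver

  choose : ℕ → ℕ → ℤ
  choose k j = + (k C j)

  choose-suc : ∀ k j → choose (suc k) (suc j) ≡ choose k (suc j) + choose k j
  choose-suc k j = cong +_ (trans (sym (nCk+nC[k+1]≡[n+1]C[k+1] k j)) (ℕ.+-comm (k C j) (k C suc j)))

  choose-0-suc : ∀ j → choose 0 (suc j) ≡ 0ℤ
  choose-0-suc j = cong +_ (k>n⇒nCk≡0 {0} {suc j} (s≤s z≤n))

  choose-absorb : ∀ k j → + suc j * choose (suc k) (suc j) ≡ + suc k * choose k j
  choose-absorb k zero = trans (ℤ.*-identityˡ _) (trans (cong +_ (nC1≡n (suc k))) (sym (ℤ.*-identityʳ _)))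
  choose-absorb zero (suc j) = trans (cong (+ suc (suc j) *_) (trans (choose-suc 0 (suc j))
    (cong₂ _+_ (choose-0-suc (suc j)) (choose-0-suc j)))) (trans (ℤ.*-zeroʳ (+ suc (suc j)))
    (sym (trans (cong (1ℤ *_) (choose-0-suc j)) refl)))
  choose-absorb (suc k) (suc j) =
    trans (cong (+ suc (suc j) *_) (choose-suc (suc k) (suc j)))
    (trans (solve 3 (λ j x y → (con 1ℤ :+ j) :* (x :+ y) := (con 1ℤ :+ j) :* x :+ (j :* y :+ y)) refl
      (+ suc j) (choose (suc k) (suc (suc j))) (choose (suc k) (suc j)))
    (trans (cong₂ (λ x y → x + (y + choose (suc k) (suc j))) (choose-absorb k (suc j)) (choose-absorb k j))
    (trans (cong (λ x → + suc k * choose k (suc j) + (+ suc k * choose k j + x)) (choose-suc k j))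
    (trans (solve 3 (λ k x y → k :* x :+ (k :* y :+ (x :+ y)) := (con 1ℤ :+ k) :* (x :+ y)) refl
      (+ suc k) (choose k (suc j)) (choose k j))
    (cong (+ suc (suc k) *_) (sym (choose-suc k j)))))))

  falling : ℕ → ℤ → ℤ
  falling zero    x = 1ℤ
  falling (suc j) x = x * falling j (x - 1ℤ)

  !*choose≡falling : ∀ j k → + (j !) * choose k j ≡ falling j (+ k)
  !*choose≡falling zero    k       = refl
  !*choose≡falling (suc j) zero    = trans (cong (+ (suc j !) *_) (choose-0-suc j)) (ℤ.*-zeroʳ (+ (suc j !)))
  !*choose≡falling (suc j) (suc k) =
    trans (cong (_* choose (suc k) (suc j)) (ℤ.pos-* (suc j) (j !)))
    (trans (solve 3 (λ a b c → (a :* b) :* c := b :* (a :* c)) refl (+ suc j) (+ (j !)) (choose (suc k) (suc j)))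
    (trans (cong (+ (j !) *_) (choose-absorb k j))
    (trans (solve 3 (λ a b c → a :* (b :* c) := b :* (a :* c)) refl (+ (j !)) (+ suc k) (choose k j))
    (cong (+ suc k *_) (!*choose≡falling j k)))))

  pronic : ℤ → ℤ
  pronic x = x * (x - 1ℤ)

  -- Two absorptions turn the right-hand side into k (k - 1) C(k - 2, i); for k = 0 and k = 1 it
  -- vanishes.
  pronic∣choose : ∀ i k → pronic (+ k) ∣ + suc (suc i) * + suc i * choose k (suc (suc i))
  pronic∣choose i zero = divides 0ℤ (trans (cong (+ suc (suc i) * + suc i *_) (choose-0-suc (suc i)))
    (ℤ.*-zeroʳ (+ suc (suc i) * + suc i)))
  pronic∣choose i (suc zero) = divides 0ℤ (trans (cong (+ suc (suc i) * + suc i *_)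
    (cong +_ (k>n⇒nCk≡0 {1} {suc (suc i)} (s≤s (s≤s z≤n))))) (ℤ.*-zeroʳ (+ suc (suc i) * + suc i)))
  pronic∣choose i (suc (suc k)) = divides (choose k i)
    (trans (solve 3 (λ a b c → (a :* b) :* c := b :* (a :* c)) refl
      (+ suc (suc i)) (+ suc i) (choose (suc (suc k)) (suc (suc i))))
    (trans (cong (+ suc i *_) (choose-absorb (suc k) (suc i)))
    (trans (solve 3 (λ a b c → a :* (b :* c) := b :* (a :* c)) refl
      (+ suc i) (+ suc (suc k)) (choose (suc k) (suc i)))
    (trans (cong (+ suc (suc k) *_) (choose-absorb k i))
    (solve 3 (λ a b c → a :* (b :* c) := c :* (a :* b)) refl (+ suc (suc k)) (+ suc k) (choose k i))))))

  ∣-*-cong-difference : ∀ {m} a b c d → m ∣ a - b → m ∣ c - d → m ∣ a * c - b * d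
  ∣-*-cong-difference {m} a b c d m∣a-b m∣c-d = subst (m ∣_)
    (solve 4 (λ a b c d → a :* (c :- d) :+ d :* (a :- b) := a :* c :- b :* d) refl a b c d)
    (∣m∣n⇒∣m+n (∣n⇒∣m*n a m∣c-d) (∣n⇒∣m*n d m∣a-b))

  -- `falling j` is a polynomial with integer coefficients and so respects congruences, which
  -- `choose` does not because of its denominator j!.
  falling-cong : ∀ {m} j x y → m ∣ x - y → m ∣ falling j x - falling j y
  falling-cong zero    x y m∣x-y = divides 0ℤ refl
  falling-cong {m} (suc j) x y m∣x-y = ∣-*-cong-difference x y _ _ m∣x-y
    (falling-cong j (x - 1ℤ) (y - 1ℤ) (subst (m ∣_)
      (solve 2 (λ x y → x :- y := (x :- con 1ℤ) :- (y :- con 1ℤ)) refl x y) m∣x-y))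

  -- iterated d j k = Σᵢ C(k, j + i) dⁱ, by iterated partial summation of (1 + d)ᵏ.
  iterated : ℤ → ℕ → ℕ → ℤ
  iterated d zero    k       = (1ℤ + d) ^ k
  iterated d (suc j) zero    = 0ℤ
  iterated d (suc j) (suc k) = iterated d (suc j) k + iterated d j k

  iterated-1 : ∀ d k → iterated d 1 k ≡ geomℤ (1ℤ + d) k
  iterated-1 d zero    = refl
  iterated-1 d (suc k) = trans (cong (_+ (1ℤ + d) ^ k) (iterated-1 d k))
    (trans (solve 3 (λ g x a → g :+ x := g :+ x :* (con 1ℤ :+ a :* con 0ℤ)) refl
      (geomℤ (1ℤ + d) k) ((1ℤ + d) ^ k) (1ℤ + d))
    (trans (sym (geomℤ-+ (1ℤ + d) k 1)) (cong (geomℤ (1ℤ + d)) (ℕ.+-comm k 1))))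

  iterated-unfold : ∀ d j k → iterated d j k ≡ choose k j + d * iterated d (suc j) k
  iterated-unfold d zero    zero    = cong (λ x → 1ℤ + x) (sym (ℤ.*-zeroʳ d))
  iterated-unfold d (suc j) zero    = sym (trans (cong₂ _+_ (choose-0-suc j) (ℤ.*-zeroʳ d)) refl)
  iterated-unfold d zero    (suc k) =
    trans (solve 2 (λ d x → (con 1ℤ :+ d) :* x := x :+ d :* x) refl d ((1ℤ + d) ^ k))
    (trans (cong (_+ d * (1ℤ + d) ^ k) (iterated-unfold d zero k))
    (solve 3 (λ d x y → (con 1ℤ :+ d :* x) :+ d :* y := con 1ℤ :+ d :* (x :+ y)) refl
      d (iterated d 1 k) ((1ℤ + d) ^ k)))
  iterated-unfold d (suc j) (suc k) =
    trans (cong₂ _+_ (iterated-unfold d (suc j) k) (iterated-unfold d j k))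
    (trans (solve 5 (λ d a b x y → (a :+ d :* x) :+ (b :+ d :* y) := (a :+ b) :+ d :* (x :+ y)) refl
      d (choose k (suc j)) (choose k j) (iterated d (suc (suc j)) k) (iterated d (suc j) k))
    (cong (_+ d * (iterated d (suc (suc j)) k + iterated d (suc j) k)) (sym (choose-suc k j))))

  iterated-vanishes : ∀ d {j k} → k ℕ.< j → iterated d j k ≡ 0ℤ
  iterated-vanishes d {suc j} {zero}  _         = refl
  iterated-vanishes d {suc j} {suc k} (s≤s k<j) = cong₂ _+_
    (iterated-vanishes d (ℕ.m≤n⇒m≤1+n k<j)) (iterated-vanishes d k<j)

  -- Unfolding peels off one term at a time, so divisibility can be checked termwise. Two tails are
  -- combined because in the cross difference of two defects the cancellation takes place between
  -- terms of equal index.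
  iterated-tail : ∀ {m} d α β k l i₀ →
    (∀ i → i₀ ℕ.≤ i → m ∣ d ^ i * (α * choose k (2 ℕ.+ i) + β * choose l (2 ℕ.+ i))) →
    m ∣ d ^ i₀ * (α * iterated d (2 ℕ.+ i₀) k + β * iterated d (2 ℕ.+ i₀) l)
  -- After k + l further steps the index exceeds both k and l, and both tails are 0.
  iterated-tail {m} d α β k l i₀ m∣terms = go (k ℕ.+ l) i₀ ℕ.≤-refl
    (s≤s (ℕ.≤-trans (ℕ.m≤m+n k l) (ℕ.m≤n+m (k ℕ.+ l) (suc i₀))))
    (s≤s (ℕ.≤-trans (ℕ.m≤n+m l k) (ℕ.m≤n+m (k ℕ.+ l) (suc i₀))))
    where
    go : ∀ fuel i → i₀ ℕ.≤ i → k ℕ.< 2 ℕ.+ i ℕ.+ fuel → l ℕ.< 2 ℕ.+ i ℕ.+ fuel →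
         m ∣ d ^ i * (α * iterated d (2 ℕ.+ i) k + β * iterated d (2 ℕ.+ i) l)
    go zero i _ k< l< = divides 0ℤ (trans
      (cong₂ (λ x y → d ^ i * (α * x + β * y))
        (iterated-vanishes d (subst (k ℕ.<_) (ℕ.+-identityʳ (2 ℕ.+ i)) k<))
        (iterated-vanishes d (subst (l ℕ.<_) (ℕ.+-identityʳ (2 ℕ.+ i)) l<)))
      (solve 3 (λ x α β → x :* (α :* con 0ℤ :+ β :* con 0ℤ) := con 0ℤ) refl (d ^ i) α β))
    go (suc fuel) i i₀≤i k< l< = subst (m ∣_)
      (trans
        (solve 8 (λ x d α β a b a′ b′ →
            x :* (α :* a :+ β :* b) :+ (d :* x) :* (α :* a′ :+ β :* b′)
            := x :* (α :* (a :+ d :* a′) :+ β :* (b :+ d :* b′))) refl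
          (d ^ i) d α β (choose k (2 ℕ.+ i)) (choose l (2 ℕ.+ i))
          (iterated d (3 ℕ.+ i) k) (iterated d (3 ℕ.+ i) l))
        (sym (cong₂ (λ x y → d ^ i * (α * x + β * y))
          (iterated-unfold d (2 ℕ.+ i) k) (iterated-unfold d (2 ℕ.+ i) l))))
      (∣m∣n⇒∣m+n (m∣terms i i₀≤i)
        (go fuel (suc i) (ℕ.m≤n⇒m≤1+n i₀≤i)
          (subst (k ℕ.<_) (ℕ.+-suc (2 ℕ.+ i) fuel) k<)
          (subst (l ℕ.<_) (ℕ.+-suc (2 ℕ.+ i) fuel) l<)))

-- The defect for q = 1 + d and its leading term.

module GeometricDefect {p : ℕ} (p-prime : Prime p) (d : ℤ.ℤ) where

  open import Data.Integer.Base using (ℤ; +_; _+_; _*_; _-_; -_; 0ℤ; 1ℤ; _^_)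
  open import Data.Integer.Divisibility.Signed
  open +-*-Solver
  open PrimePowers p-prime
  open IteratedSums

  defect : ℕ → ℤ
  defect k = + 2 * iterated d 2 k

  geomℤ-defect : ∀ k → geomℤ (1ℤ + d) k - + k ≡ d * iterated d 2 k
  geomℤ-defect k = trans (cong (_- + k) (trans (sym (iterated-1 d k)) (trans (iterated-unfold d 1 k)
      (cong (_+ d * iterated d 2 k) (cong +_ (nC1≡n k))))))
    (solve 2 (λ k x → (k :+ x) :- k := x) refl (+ k) (d * iterated d 2 k))

  defect-leading : ∀ k → defect k - pronic (+ k) ≡ + 2 * (d ^ 1 * iterated d 3 k)
  defect-leading k =
    trans (cong₂ (λ x y → + 2 * x - y) (iterated-unfold d 2 k)
      (trans (cong (+ k *_) (sym (ℤ.*-identityʳ (+ k - 1ℤ)))) (sym (!*choose≡falling 2 k))))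
    (solve 3 (λ c d x → con (+ 2) :* (c :+ d :* x) :- con (+ 2) :* c := con (+ 2) :* (d :* con 1ℤ :* x)) refl
      (choose k 2) d (iterated d 3 k))

  -- Since (i + 2)(i + 1) C(k, i + 2) is a multiple of k (k - 1), this makes the term
  -- 2 dⁱ C(k, i + 2) of the defect divisible by a higher power of p than k (k - 1) is.
  HighOrder : ℕ → Set
  HighOrder i = ∃ λ t → p^ t ∣ + 2 * d ^ i × ¬ p^ t ∣ + suc (suc i) * + suc i

  -- In each term k (k - 1) and 2 dⁱ together supply p^(n+t), of which the denominator (i + 2)(i +
  -- 1) removes at most t - 1 factors p. The coefficient 0 switches off the second tail of
  -- `iterated-tail`.
  high-order-tail : ∀ i₀ k n → (∀ i → i₀ ℕ.≤ i → HighOrder i) → p^ n ∣ pronic (+ k) →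
                    p^ (suc n) ∣ + 2 * (d ^ i₀ * iterated d (2 ℕ.+ i₀) k)
  high-order-tail i₀ k n high p^n∣k[k-1] = subst (p^ (suc n) ∣_)
    (solve 3 (λ x a b → x :* (con (+ 2) :* a :+ con 0ℤ :* b) := con (+ 2) :* (x :* a)) refl
      (d ^ i₀) (iterated d (2 ℕ.+ i₀) k) (iterated d (2 ℕ.+ i₀) 0))
    (iterated-tail d (+ 2) 0ℤ k 0 i₀ term)
    where
    term : ∀ i → i₀ ℕ.≤ i → p^ (suc n) ∣ d ^ i * (+ 2 * choose k (2 ℕ.+ i) + 0ℤ * choose 0 (2 ℕ.+ i))
    term i i₀≤i with high i i₀≤i
    ... | t , p^t∣2dⁱ , p^t∤ = ∤-cancel t n p^t∤ (subst (p^ (n ℕ.+ t) ∣_)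
      (solve 5 (λ a b c x y → (a :* b :* c) :* (con (+ 2) :* x)
          := (a :* b) :* (x :* (con (+ 2) :* c :+ con 0ℤ :* y))) refl
        (+ suc (suc i)) (+ suc i) (choose k (2 ℕ.+ i)) (d ^ i) (choose 0 (2 ℕ.+ i)))
      (*-pres-p^∣ {n} {t} (∣-trans p^n∣k[k-1] (pronic∣choose i k)) p^t∣2dⁱ))

  -- Consecutive integers are coprime, so pᵗ would have to divide one of them, and both are positive
  -- and smaller than pᵗ.
  consecutive-∤ : ∀ t i → suc (suc i) ℕ.< p ℕ.^ t → ¬ p^ t ∣ + suc (suc i) * + suc i
  consecutive-∤ t i i+2<p^t d with + p ∣? + suc i
  ... | no p∤i+1 = ℕ.<⇒≱ i+2<p^t (ℕ.∣⇒≤ (∣⇒∣ᵤ (unit-cancel t {+ suc i} {+ suc (suc i)} p∤i+1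
    (subst (p^ t ∣_) (ℤ.*-comm (+ suc (suc i)) (+ suc i)) d))))
  ... | yes p∣i+1 = ℕ.<⇒≱ i+2<p^t (ℕ.m≤n⇒m≤1+n
          (ℕ.∣⇒≤ (∣⇒∣ᵤ (unit-cancel t {+ suc (suc i)} {+ suc i} p∤i+2 d))))
    where
    p∤i+2 : ¬ + p ∣ + suc (suc i)
    p∤i+2 p∣i+2 = p∤1 (∣m+n∣n⇒∣m {m = 1ℤ} {+ suc i} p∣i+2 p∣i+1)

  -- The error in x ≈ y g is of higher order than y, and g is a unit. For `to`, divisibility of y by
  -- pⁿ makes the error divisible by p^(n+1), which is enough to climb from n to n + 1.
  same-valuation : ∀ {x y g} → ¬ + p ∣ g → (∀ n → p^ n ∣ y → p^ (suc n) ∣ x - y * g) →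
                   ∀ n → (p^ n ∣ x → p^ n ∣ y) × (p^ n ∣ y → p^ n ∣ x)
  same-valuation {x} {y} {g} p∤g close n = to n , from
    where
    to : ∀ n → p^ n ∣ x → p^ n ∣ y
    to zero    _        = divides y (sym (ℤ.*-identityʳ y))
    to (suc n) p^n+1∣x = unit-cancel (suc n) {g} p∤g (subst (p^ (suc n) ∣_)
      (solve 3 (λ x y g → x :- (x :- y :* g) := g :* y) refl x y g)
      (∣m∣n⇒∣m-n p^n+1∣x (close n (to n (p^-weaken (ℕ.n≤1+n n) p^n+1∣x)))))

    from : p^ n ∣ y → p^ n ∣ x
    from p^n∣y = subst (p^ n ∣_) (solve 3 (λ x y g → (x :- y :* g) :+ y :* g := x) refl x y g)
      (∣m∣n⇒∣m+n (p^-weaken (ℕ.n≤1+n n) (close n p^n∣y)) (∣m⇒∣m*n g p^n∣y))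

  defect-valuation : (∀ i → 1 ℕ.≤ i → HighOrder i) → ∀ k n →
                     (p^ n ∣ defect k → p^ n ∣ pronic (+ k)) × (p^ n ∣ pronic (+ k) → p^ n ∣ defect k)
  defect-valuation high k = same-valuation {defect k} {pronic (+ k)} {1ℤ} p∤1 λ n d → subst (p^ (suc n) ∣_)
    (trans (sym (defect-leading k)) (cong (λ x → defect k - x) (sym (ℤ.*-identityʳ (pronic (+ k))))))
    (high-order-tail 1 k n high d)

  ^-p^∣ : ∀ {m} → p^ m ∣ d → ∀ i → p^ (m ℕ.* i) ∣ d ^ i
  ^-p^∣ {m} p^m∣d zero    = subst (λ e → p^ e ∣ 1ℤ) (sym (ℕ.*-zeroʳ m)) ∣-refl
  ^-p^∣ {m} p^m∣d (suc i) = subst (λ e → p^ e ∣ d ^ suc i) (sym (ℕ.*-suc m i))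
    (*-pres-p^∣ {m} {m ℕ.* i} p^m∣d (^-p^∣ {m} p^m∣d i))

  i+2<b^i : ∀ {b} → 5 ℕ.≤ b → ∀ i → 1 ℕ.≤ i → suc (suc i) ℕ.< b ℕ.^ i
  i+2<b^i {b} 5≤b (suc zero) _ = ℕ.≤-trans (ℕ.m≤n⇒m≤1+n ℕ.≤-refl)
    (ℕ.≤-trans 5≤b (ℕ.≤-reflexive (sym (ℕ.*-identityʳ b))))
  i+2<b^i {b} 5≤b (suc (suc i)) _ = ℕ.≤-trans
    (ℕ.≤-trans (s≤s (i+2<b^i 5≤b (suc i) (s≤s z≤n)))
      (ℕ.+-mono-≤ (ℕ.m^n>0 b {{ℕ.>-nonZero (ℕ.≤-trans (s≤s z≤n) 5≤b)}} (suc i))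
        (ℕ.m≤m+n (b ℕ.^ suc i) 0)))
    (ℕ.*-monoˡ-≤ (b ℕ.^ suc i) {2} {b} (ℕ.≤-trans (s≤s (s≤s z≤n)) 5≤b))

  i+2<2^[i+1] : ∀ i → 1 ℕ.≤ i → suc (suc i) ℕ.< 2 ℕ.^ suc i
  i+2<2^[i+1] (suc zero)    _ = ℕ.≤-refl
  i+2<2^[i+1] (suc (suc i)) _ = ℕ.≤-trans (s≤s (i+2<2^[i+1] (suc i) (s≤s z≤n)))
    (ℕ.+-mono-≤ (ℕ.m^n>0 2 (suc (suc i))) (ℕ.m≤m+n (2 ℕ.^ suc (suc i)) 0))

  -- The witness t = m i works because 5ⁱ > i + 2. For odd p and m ≥ 1 the bound excludes exactly p
  -- = 3, m = 1.
  p^m≥5⇒high-order : ∀ {m} → p^ m ∣ d → 5 ℕ.≤ p ℕ.^ m → ∀ i → 1 ℕ.≤ i → HighOrder i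
  p^m≥5⇒high-order {m} p^m∣d 5≤p^m i 1≤i = m ℕ.* i , ∣n⇒∣m*n (+ 2) (^-p^∣ {m} p^m∣d i) ,
    consecutive-∤ (m ℕ.* i) i (subst (suc (suc i) ℕ.<_) (ℕ.^-*-assoc p m i) (i+2<b^i 5≤p^m i 1≤i))

  -- The factor 2 of 2 dⁱ supplies one more power of 2, so that t = i + 1 is available; t = i would
  -- fail for i = 1 and i = 2.
  p≡2⇒high-order : p ≡ 2 → + p ∣ d → ∀ i → 1 ℕ.≤ i → HighOrder i
  p≡2⇒high-order refl p∣d i 1≤i = suc i ,
    *-pres-p^∣ {1} {i} (divides 1ℤ refl)
      (subst (λ e → p^ e ∣ d ^ i) (ℕ.+-identityʳ i) (^-p^∣ {1} p∣d i)) ,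
    consecutive-∤ (suc i) i (i+2<2^[i+1] i 1≤i)

  p^[m+e]∣geomℤ-defect : ∀ {m} e k → m ∥ d →
    (p^ (m ℕ.+ e) ∣ geomℤ (1ℤ + d) k - + k → p^ e ∣ iterated d 2 k) ×
    (p^ e ∣ iterated d 2 k → p^ (m ℕ.+ e) ∣ geomℤ (1ℤ + d) k - + k)
  p^[m+e]∣geomℤ-defect {m} e k m∥d =
    (λ x → ∥-cancel {m} e m∥d (subst (p^ (m ℕ.+ e) ∣_) (geomℤ-defect k) x)) ,
    (λ x → subst (p^ (m ℕ.+ e) ∣_) (sym (geomℤ-defect k)) (*-pres-p^∣ {m} {e} (proj₁ m∥d) x))

-- Arithmetic modulo 3 and the 3-adic valuation of factorials.

module ModuloThree {p : ℕ} (p-prime : Prime p) (p≡3 : p ≡ 3) where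

  open import Data.Integer.Base using (ℤ; +_; _+_; _*_; _-_; -_; 0ℤ; 1ℤ; _%ℕ_; _/ℕ_)
  open import Data.Integer.Divisibility.Signed
  open +-*-Solver
  open PrimePowers p-prime
  open IteratedSums

  p≡3ℤ : + p ≡ + 3
  p≡3ℤ = cong +_ p≡3

  residue₃ : ∀ x → + 3 ∣ x ⊎ + 3 ∣ x - 1ℤ ⊎ + 3 ∣ x + 1ℤ
  residue₃ x with x %ℕ 3 | ℤ.a≡a%ℕn+[a/ℕn]*n x 3 | ℤ.n%ℕd<d x 3
  ... | 0 | eq | _ = inj₁ (divides (x /ℕ 3) (trans eq (ℤ.+-identityˡ _)))
  ... | 1 | eq | _ = inj₂ (inj₁ (divides (x /ℕ 3) (trans (cong (_- 1ℤ) eq)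
    (solve 1 (λ y → (con 1ℤ :+ y) :- con 1ℤ := y) refl (x /ℕ 3 * + 3)))))
  ... | 2 | eq | _ = inj₂ (inj₂ (divides (1ℤ + x /ℕ 3) (trans (cong (_+ 1ℤ) eq)
    (solve 1 (λ y → (con (+ 2) :+ y :* con (+ 3)) :+ con 1ℤ := (con 1ℤ :+ y) :* con (+ 3)) refl (x /ℕ 3)))))
  ... | suc (suc (suc _)) | _ | s≤s (s≤s (s≤s ()))

  residue-p : ∀ x → + p ∣ x ⊎ + p ∣ x - 1ℤ ⊎ + p ∣ x + 1ℤ
  residue-p x = subst (λ y → y ∣ x ⊎ y ∣ x - 1ℤ ⊎ y ∣ x + 1ℤ) (sym p≡3ℤ) (residue₃ x)

  p∣x²-1 : ∀ {x} → ¬ + p ∣ x → + p ∣ x * x - 1ℤ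
  p∣x²-1 {x} p∤x with residue-p x
  ... | inj₁ d = contradiction d p∤x
  ... | inj₂ (inj₁ d) = subst (+ p ∣_)
    (solve 1 (λ x → (x :+ con 1ℤ) :* (x :- con 1ℤ) := x :* x :- con 1ℤ) refl x)
    (∣n⇒∣m*n (x + 1ℤ) d)
  ... | inj₂ (inj₂ d) = subst (+ p ∣_)
    (solve 1 (λ x → (x :- con 1ℤ) :* (x :+ con 1ℤ) := x :* x :- con 1ℤ) refl x)
    (∣n⇒∣m*n (x - 1ℤ) d)

  p∤2 : ¬ + p ∣ + 2
  p∤2 p∣2 = ℕ.<⇒≱ (subst (2 ℕ.<_) (sym p≡3) (s≤s (s≤s (s≤s z≤n)))) (ℕ.∣⇒≤ (∣⇒∣ᵤ p∣2))

  -- A unit modulo 3 is its own inverse, so t can be the residue of - x y.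
  solve-linear : ∀ {x} → ¬ + p ∣ x → ∀ y → ∃ λ t → + p ∣ y + x * + t
  solve-linear {x} p∤x y = t , subst (+ p ∣_)
    (trans (solve 4 (λ x y p q → y :* (con 1ℤ :- x :* x) :+ (:- x :* q) :* p
        := y :+ x :* (:- (x :* y) :- q :* p)) refl x y (+ p) (z /ℕ p))
    (cong (λ s → y + x * s) z-qp≡t))
    (∣m∣n⇒∣m+n (∣n⇒∣m*n y (subst (+ p ∣_) (solve 1 (λ x → :- (x :* x :- con 1ℤ) := con 1ℤ :- x :* x) refl x)
      (∣m⇒∣-m (p∣x²-1 p∤x)))) (∣n⇒∣m*n (- x * (z /ℕ p)) ∣-refl))
    where
    z : ℤ
    z = - (x * y)

    t : ℕ
    t = z %ℕ p

    z-qp≡t : z - z /ℕ p * + p ≡ + t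
    z-qp≡t = trans (cong (_- z /ℕ p * + p) (ℤ.a≡a%ℕn+[a/ℕn]*n z p))
      (solve 2 (λ t y → (t :+ y) :- y := t) refl (+ t) (z /ℕ p * + p))

  fac : ℕ → ℤ
  fac j = + (j !)

  fac-suc : ∀ j → fac (suc j) ≡ + suc j * fac j
  fac-suc j = ℤ.pos-* (suc j) (j !)

  p∤r+3i : ∀ {r} i → ¬ + p ∣ + r → ¬ + p ∣ + (r ℕ.+ i ℕ.* 3)
  p∤r+3i {r} i p∤r d = p∤r (∣m+n∣n⇒∣m {m = + r} {+ (i ℕ.* 3)} d
    (subst (_∣ + (i ℕ.* 3)) (sym p≡3ℤ) (divides (+ i) (ℤ.pos-* i 3))))

  -- The multiples of 3 among the factors contribute 3ⁱ i!, the others the unit s.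
  fac-3i : ∀ i → ∃ λ s → ¬ + p ∣ s × fac (i ℕ.* 3) ≡ p^ i * fac i * s
  fac-3i zero    = 1ℤ , p∤1 , refl
  fac-3i (suc i) with fac-3i i
  ... | s , p∤s , eq = s * (+ (2 ℕ.+ i ℕ.* 3) * + (1 ℕ.+ i ℕ.* 3)) ,
    p∤* p∤s (p∤* (p∤r+3i {2} i p∤2) (p∤r+3i {1} i p∤1)) ,
    trans (fac-suc (2 ℕ.+ i ℕ.* 3)) (trans (cong₂ _*_
      (trans (ℤ.pos-* (suc i) 3) (cong (+ suc i *_) (sym p≡3ℤ)))
      (trans (fac-suc (1 ℕ.+ i ℕ.* 3)) (cong (+ (2 ℕ.+ i ℕ.* 3) *_)
        (trans (fac-suc (i ℕ.* 3)) (cong (+ (1 ℕ.+ i ℕ.* 3) *_) eq)))))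
    (trans (solve 7 (λ i p x y a b c → (i :* p) :* (x :* (y :* ((a :* b) :* c)))
        := ((p :* a) :* (i :* b)) :* (c :* (x :* y))) refl
      (+ suc i) (+ p) (+ (2 ℕ.+ i ℕ.* 3)) (+ (1 ℕ.+ i ℕ.* 3)) (p^ i) (fac i) s)
    (cong₂ (λ x y → x * y * (s * (+ (2 ℕ.+ i ℕ.* 3) * + (1 ℕ.+ i ℕ.* 3))))
      (sym (p^-suc i)) (sym (fac-suc i)))))

  fac-r+3i : ∀ (r : Fin 3) i → ∃ λ s → ¬ + p ∣ s × fac (toℕ r ℕ.+ i ℕ.* 3) ≡ p^ i * fac i * s
  fac-r+3i Fin.zero i = fac-3i i
  fac-r+3i (Fin.suc Fin.zero) i with fac-3i i
  ... | s , p∤s , eq = + (1 ℕ.+ i ℕ.* 3) * s , p∤* (p∤r+3i {1} i p∤1) p∤s ,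
    trans (fac-suc (i ℕ.* 3)) (trans (cong (+ (1 ℕ.+ i ℕ.* 3) *_) eq)
    (solve 3 (λ x a c → x :* (a :* c) := a :* (x :* c)) refl (+ (1 ℕ.+ i ℕ.* 3)) (p^ i * fac i) s))
  fac-r+3i (Fin.suc (Fin.suc Fin.zero)) i with fac-r+3i (Fin.suc Fin.zero) i
  ... | s , p∤s , eq = + (2 ℕ.+ i ℕ.* 3) * s , p∤* (p∤r+3i {2} i p∤2) p∤s ,
    trans (fac-suc (1 ℕ.+ i ℕ.* 3)) (trans (cong (+ (2 ℕ.+ i ℕ.* 3) *_) eq)
    (solve 3 (λ x a c → x :* (a :* c) := a :* (x :* c)) refl (+ (2 ℕ.+ i ℕ.* 3)) (p^ i * fac i) s))

  p^e∣1⇒e≡0 : ∀ e → p^ e ∣ 1ℤ → e ≡ 0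
  p^e∣1⇒e≡0 zero    _ = refl
  p^e∣1⇒e≡0 (suc e) d = contradiction (p^suc∣⇒p∣ {e} {1ℤ} d) p∤1

  -- A consequence of Legendre's formula. For j = r + 3 i with r < 3 the valuation of j! is i plus
  -- that of i!; if i ≥ 1, strong induction bounds its double by less than 2 i + i ≤ j.
  legendre : ∀ j → 1 ℕ.≤ j → ∀ e → p^ e ∣ fac j → 2 ℕ.* e ℕ.< j
  legendre = <-rec (λ j → 1 ℕ.≤ j → ∀ e → p^ e ∣ fac j → 2 ℕ.* e ℕ.< j) step
    where
    step : ∀ j → (∀ {i} → i ℕ.< j → 1 ℕ.≤ i → ∀ e → p^ e ∣ fac i → 2 ℕ.* e ℕ.< i) →
           1 ℕ.≤ j → ∀ e → p^ e ∣ fac j → 2 ℕ.* e ℕ.< j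
    step j rec 1≤j e d with j ℕ.divMod 3
    ... | ℕ.result i r refl with fac-r+3i r i
    ... | s , p∤s , eq = bound i refl (unit-cancel e p∤s (subst (p^ e ∣_)
            (trans eq (ℤ.*-comm (p^ i * fac i) s)) d))
      where
      3i≤j : i ℕ.* 3 ℕ.≤ toℕ r ℕ.+ i ℕ.* 3
      3i≤j = ℕ.m≤n+m (i ℕ.* 3) (toℕ r)

      2e<3i : ∀ {e i} → 2 ℕ.* e ℕ.< 3 ℕ.* i → i ℕ.* 3 ℕ.≤ toℕ r ℕ.+ i ℕ.* 3 → 2 ℕ.* e ℕ.< toℕ r ℕ.+ i ℕ.* 3
      2e<3i {e} {i} 2e<3i le = ℕ.≤-trans 2e<3i (ℕ.≤-trans (ℕ.≤-reflexive (ℕ.*-comm 3 i)) le)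

      bound : ∀ i′ → i ≡ i′ → p^ e ∣ p^ i * fac i → 2 ℕ.* e ℕ.< toℕ r ℕ.+ i ℕ.* 3
      bound zero refl d = subst (λ e → 2 ℕ.* e ℕ.< toℕ r ℕ.+ 0) (sym (p^e∣1⇒e≡0 e d)) 1≤j
      -- The induction hypothesis concerns the exponent e - i; for e ≤ i the bound 2 e ≤ 2 i < 3 i
      -- is immediate.
      bound (suc i′) refl d with e ℕ.≤? i
      ... | yes e≤i = 2e<3i {e} {i} (ℕ.≤-<-trans (ℕ.*-monoʳ-≤ 2 e≤i)
                        (ℕ.*-monoˡ-< (suc i′) (ℕ.n<1+n 2))) 3i≤j
      ... | no  e≰i = 2e<3i {e} {i} (begin-strict
          2 ℕ.* e                          ≡⟨ cong (2 ℕ.*_) (sym i+e′≡e) ⟩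
          2 ℕ.* (i ℕ.+ e′)                 ≡⟨ ℕ.*-distribˡ-+ 2 i e′ ⟩
          2 ℕ.* i ℕ.+ 2 ℕ.* e′             <⟨ ℕ.+-monoʳ-< (2 ℕ.* i) (rec i<j (s≤s z≤n) e′ p^e′∣i!) ⟩
          2 ℕ.* i ℕ.+ i                    ≡⟨ ℕ.+-comm (2 ℕ.* i) i ⟩
          3 ℕ.* i                          ∎) 3i≤j
        where
        open ℕ.≤-Reasoning
        e′ : ℕ
        e′ = e ℕ.∸ i
        i+e′≡e : i ℕ.+ e′ ≡ e
        i+e′≡e = ℕ.m+[n∸m]≡n (ℕ.<⇒≤ (ℕ.≰⇒> e≰i))
        i<j : i ℕ.< toℕ r ℕ.+ i ℕ.* 3
        i<j = ℕ.≤-trans (s≤s (s≤s (ℕ.≤-trans (ℕ.m≤m*n i′ 3) (ℕ.n≤1+n (i′ ℕ.* 3))))) 3i≤j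
        p^e′∣i! : p^ e′ ∣ fac i
        p^e′∣i! = *-cancelˡ-∣ (p^ i) {{ℕ.m^n≢0 p i}}
          (subst (_∣ p^ i * fac i) (trans (cong p^ (sym i+e′≡e)) (p^-+ i e′)) d)

  -- By `legendre`, as 2 i ≥ i + 2. For i = 1 it fails, since 3 divides 3!; that term is treated
  -- explicitly.
  p^i∤[2+i]! : ∀ i → 2 ℕ.≤ i → ¬ p^ i ∣ fac (2 ℕ.+ i)
  p^i∤[2+i]! i 2≤i d = ℕ.<⇒≱ (legendre (2 ℕ.+ i) (s≤s z≤n) i d)
    (ℕ.≤-trans (ℕ.+-monoˡ-≤ i 2≤i) (ℕ.≤-reflexive (cong (i ℕ.+_) (sym (ℕ.+-identityʳ i)))))

  -- Modulo 3 the zero r of 1 + u (x - 2) is 1 for u ≡ 1 and 0 for u ≡ - 1; it is never 2, where the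
  -- value is 1. The other root of x (x - 1) is s.
  critical-residue : ∀ {u} → ¬ + p ∣ u → ∃ λ r → ∃ λ s → (∀ x → pronic x ≡ (x - + r) * (x - + s)) ×
                     ¬ + p ∣ + r - + s × + p ∣ 1ℤ + u * (+ r - + 2)
  critical-residue {u} p∤u with residue-p u
  ... | inj₁ p∣u = contradiction p∣u p∤u
  ... | inj₂ (inj₁ p∣u-1) = 1 , 0 ,
    (λ x → solve 1 (λ x → x :* (x :- con 1ℤ) := (x :- con 1ℤ) :* (x :- con 0ℤ)) refl x) , p∤1 ,
    subst (+ p ∣_) (solve 1 (λ u → :- (u :- con 1ℤ) := con 1ℤ :+ u :* (con 1ℤ :- con (+ 2))) refl u)
      (∣m⇒∣-m p∣u-1)
  ... | inj₂ (inj₂ p∣u+1) = 0 , 1 ,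
    (λ x → solve 1 (λ x → x :* (x :- con 1ℤ) := (x :- con 0ℤ) :* (x :- con 1ℤ)) refl x) ,
    (λ p∣-1 → p∤1 (∣m⇒∣-m p∣-1)) ,
    subst (+ p ∣_) (solve 1 (λ u → con (- (+ 2)) :* (u :+ con 1ℤ) :+ con (+ 3)
        := con 1ℤ :+ u :* (con 0ℤ :- con (+ 2))) refl u)
      (∣m∣n⇒∣m+n (∣n⇒∣m*n (- (+ 2)) p∣u+1) (∣-reflexive p≡3ℤ))

-- The defect for p = 3 and q - 1 of valuation 1.

module FirstOrderAtThree {p : ℕ} (p-prime : Prime p) (p≡3 : p ≡ 3)
  (u : ℤ.ℤ) (p∤u : ¬ ℤ.+ p ℤ.∣ u) (r s : ℤ.ℤ)
  (pronic-factors : ∀ x → IteratedSums.pronic x ≡ (x ℤ.- r) ℤ.* (x ℤ.- s))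
  (p∤r-s : ¬ ℤ.+ p ℤ.∣ r ℤ.- s) (p∣1+u[r-2] : ℤ.+ p ℤ.∣ ℤ.1ℤ ℤ.+ u ℤ.* (r ℤ.- ℤ.+ 2)) where

  open import Data.Integer.Base using (ℤ; +_; _+_; _*_; _-_; -_; 0ℤ; 1ℤ; _^_)
  open import Data.Integer.Divisibility.Signed
  open +-*-Solver
  open PrimePowers p-prime
  open IteratedSums
  open ModuloThree p-prime p≡3

  d : ℤ
  d = u * + p

  open GeometricDefect p-prime d

  K : ℕ → ℤ
  K k = pronic (+ k)

  -- The first two terms of the defect divided by k (k - 1); it gives b(k) modulo 3.
  slope : ℕ → ℤ
  slope k = 1ℤ + u * (+ k - + 2)

  defect-expansion : ∀ k → defect k ≡ K k * slope k + + 2 * (d ^ 2 * iterated d 4 k)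
  defect-expansion k =
    trans (solve 2 (λ f y → f := (f :- y) :+ y) refl (defect k) (K k))
    (trans (cong (_+ K k) (trans (defect-leading k) (cong (λ x → + 2 * (d ^ 1 * x)) (iterated-unfold d 3 k))))
    (trans (solve 5 (λ u p c e y → con (+ 2) :* (((u :* p) :* con 1ℤ) :* (c :+ (u :* p) :* e)) :+ y
        := (y :+ u :* (con (+ 2) :* p :* c)) :+ con (+ 2) :* ((u :* p) :* ((u :* p) :* con 1ℤ) :* e)) refl
      u (+ p) (choose k 3) (iterated d 4 k) (K k))
    (cong (_+ + 2 * (d ^ 2 * iterated d 4 k))
      -- For p = 3 the factor 2 p is 3!, which clears the denominator of C(k, 3).
      (trans (cong (λ x → K k + u * x) (trans (cong (λ x → + 2 * x * choose k 3) p≡3ℤ) (!*choose≡falling 3 k)))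
      (solve 2 (λ k u → k :* (k :- con 1ℤ) :+ u :* (k :* ((k :- con 1ℤ) :* (((k :- con 1ℤ) :- con 1ℤ) :* con 1ℤ)))
        := (k :* (k :- con 1ℤ)) :* (con 1ℤ :+ u :* (k :- con (+ 2)))) refl (+ k) u)))))

  d^-p^∣ : ∀ i → p^ i ∣ d ^ i
  d^-p^∣ i = subst (λ e → p^ e ∣ d ^ i) (ℕ.+-identityʳ i)
    (^-p^∣ {1} (∣n⇒∣m*n u (subst (_∣ + p) (sym p^1) ∣-refl)) i)

  i+2<3^i : ∀ i → 2 ℕ.≤ i → suc (suc i) ℕ.< 3 ℕ.^ i
  i+2<3^i (suc zero) (s≤s ())
  i+2<3^i (suc (suc zero)) _ = s≤s (s≤s (s≤s (s≤s (s≤s z≤n))))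
  i+2<3^i (suc (suc (suc i))) _ = ℕ.≤-trans (s≤s (i+2<3^i (suc (suc i)) (s≤s (s≤s z≤n))))
    (ℕ.+-mono-≤ (ℕ.m^n>0 3 (suc (suc i))) (ℕ.m≤m+n (3 ℕ.^ suc (suc i)) _))

  high-order : ∀ i → 2 ℕ.≤ i → HighOrder i
  high-order i 2≤i = i , ∣n⇒∣m*n (+ 2) (d^-p^∣ i) ,
    consecutive-∤ i i (subst (λ x → suc (suc i) ℕ.< x ℕ.^ i) (sym p≡3) (i+2<3^i i 2≤i))

  defect≡K*slope : ∀ k a → p^ a ∣ K k → p^ (suc a) ∣ defect k - K k * slope k
  defect≡K*slope k a p^a∣K = subst (p^ (suc a) ∣_)
    (trans (solve 2 (λ x y → y := (x :+ y) :- x) refl (K k * slope k) (+ 2 * (d ^ 2 * iterated d 4 k)))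
      (cong (_- K k * slope k) (sym (defect-expansion k))))
    (high-order-tail 2 k a high-order p^a∣K)

  slope-split : ∀ k → slope k ≡ (1ℤ + u * (r - + 2)) + u * (+ k - r)
  slope-split k = solve 3 (λ u k r → con 1ℤ :+ u :* (k :- con (+ 2))
    := (con 1ℤ :+ u :* (r :- con (+ 2))) :+ u :* (k :- r)) refl u (+ k) r

  p∣slope : ∀ {k} → + p ∣ + k - r → + p ∣ slope k
  p∣slope {k} p∣k-r = subst (+ p ∣_) (sym (slope-split k)) (∣m∣n⇒∣m+n p∣1+u[r-2] (∣n⇒∣m*n u p∣k-r))

  p∤slope : ∀ {k} → ¬ + p ∣ + k - r → ¬ + p ∣ slope k
  p∤slope {k} p∤k-r p∣slope = p∤* p∤u p∤k-r
    (∣m+n∣m⇒∣n (subst (+ p ∣_) (slope-split k) p∣slope) p∣1+u[r-2])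

  -- Off the residue class of r the slope is a unit, so the defect behaves as in the regular case.
  away-from-r : ∀ {k} → ¬ + p ∣ + k - r → ∀ n →
                (p^ n ∣ defect k → p^ n ∣ K k) × (p^ n ∣ K k → p^ n ∣ defect k)
  away-from-r {k} p∤k-r = same-valuation {defect k} {K k} {slope k} (p∤slope p∤k-r) (defect≡K*slope k)

  gains-one : ∀ {k a} → + p ∣ + k - r → p^ a ∣ K k → p^ (suc a) ∣ defect k
  gains-one {k} {a} p∣k-r p^a∣K = subst (p^ (suc a) ∣_)
    (solve 2 (λ x y → (x :- y) :+ y := x) refl (defect k) (K k * slope k))
    (∣m∣n⇒∣m+n (defect≡K*slope k a p^a∣K)
      (subst (λ e → p^ e ∣ K k * slope k) (ℕ.+-comm a 1)
        (*-pres-p^∣ {a} {1} p^a∣K (p∣⇒p^1∣ (p∣slope p∣k-r)))))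

  -- This is K k · K l · (b(k) - b(l)), the difference of two values of b with denominators cleared.
  cross : ℕ → ℕ → ℤ
  cross k l = K l * defect k - K k * defect l

  cross-expansion : ∀ k l → cross k l - u * (K k * K l * (+ k - + l))
    ≡ d ^ 2 * (+ 2 * K l * iterated d 4 k + - (+ 2 * K k) * iterated d 4 l)
  cross-expansion k l = trans
    (cong₂ (λ x y → K l * x - K k * y - u * (K k * K l * (+ k - + l))) (defect-expansion k) (defect-expansion l))
    (solve 8 (λ a b k l u x e e′ →
        (b :* (a :* (con 1ℤ :+ u :* (k :- con (+ 2))) :+ con (+ 2) :* (x :* e))
          :- a :* (b :* (con 1ℤ :+ u :* (l :- con (+ 2))) :+ con (+ 2) :* (x :* e′)))
          :- u :* (a :* b :* (k :- l))
        := x :* (con (+ 2) :* b :* e :+ :- (con (+ 2) :* a) :* e′)) refl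
      (K k) (K l) (+ k) (+ l) u (d ^ 2) (iterated d 4 k) (iterated d 4 l))

  -- Multiplied by (2 + i)!, the i-th term of the cross difference is an integer
  -- polynomial divisible by K k · K l · (k - l); dⁱ more than compensates (2 + i)!.
  cross-leading : ∀ {k l} a b c → p^ a ∣ K k → p^ b ∣ K l → p^ c ∣ + k - + l →
                  p^ (suc (a ℕ.+ b ℕ.+ c)) ∣ cross k l - u * (K k * K l * (+ k - + l))
  cross-leading {k} {l} a b c p^a∣ p^b∣ p^c∣ = subst (p^ (suc (a ℕ.+ b ℕ.+ c)) ∣_) (sym (cross-expansion k l))
    (iterated-tail d (+ 2 * K l) (- (+ 2 * K k)) k l 2 term)
    where
    k-2 l-2 : ℤ
    k-2 = + k - 1ℤ - 1ℤ
    l-2 = + l - 1ℤ - 1ℤ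

    term : ∀ i → 2 ℕ.≤ i → p^ (suc (a ℕ.+ b ℕ.+ c)) ∣
           d ^ i * (+ 2 * K l * choose k (2 ℕ.+ i) + - (+ 2 * K k) * choose l (2 ℕ.+ i))
    term i 2≤i = ∤-cancel i (a ℕ.+ b ℕ.+ c) (p^i∤[2+i]! i 2≤i) (subst (p^ (a ℕ.+ b ℕ.+ c ℕ.+ i) ∣_)
      (trans (solve 5 (λ k l x f g →
            ((k :* (k :- con 1ℤ)) :* (l :* (l :- con 1ℤ)) :* (f :- g)) :* (con (+ 2) :* x)
            := x :* (con (+ 2) :* (l :* (l :- con 1ℤ)) :* (k :* ((k :- con 1ℤ) :* f))
                  :+ :- (con (+ 2) :* (k :* (k :- con 1ℤ))) :* (l :* ((l :- con 1ℤ) :* g)))) refl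
          (+ k) (+ l) (d ^ i) (falling i k-2) (falling i l-2))
        (trans (cong₂ (λ x y → d ^ i * (+ 2 * K l * x + - (+ 2 * K k) * y))
          (sym (!*choose≡falling (2 ℕ.+ i) k)) (sym (!*choose≡falling (2 ℕ.+ i) l)))
        (solve 6 (λ x y z n c c′ → x :* (y :* (n :* c) :+ z :* (n :* c′)) := n :* (x :* (y :* c :+ z :* c′))) refl
          (d ^ i) (+ 2 * K l) (- (+ 2 * K k)) (fac (2 ℕ.+ i)) (choose k (2 ℕ.+ i)) (choose l (2 ℕ.+ i)))))
      (*-pres-p^∣ {a ℕ.+ b ℕ.+ c} {i}
        (*-pres-p^∣ {a ℕ.+ b} {c} (*-pres-p^∣ {a} {b} p^a∣ p^b∣)
          (falling-cong i k-2 l-2 (subst (p^ c ∣_)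
            (solve 2 (λ k l → k :- l := (k :- con 1ℤ :- con 1ℤ) :- (l :- con 1ℤ :- con 1ℤ)) refl (+ k) (+ l)) p^c∣)))
        (∣n⇒∣m*n (+ 2) (d^-p^∣ i))))

  u*product : ∀ {k l} a b c → p^ a ∣ K k → p^ b ∣ K l → p^ c ∣ + k - + l →
              p^ (a ℕ.+ b ℕ.+ c) ∣ u * (K k * K l * (+ k - + l))
  u*product a b c p^a∣ p^b∣ p^c∣ = ∣n⇒∣m*n u (*-pres-p^∣ {a ℕ.+ b} {c} (*-pres-p^∣ {a} {b} p^a∣ p^b∣) p^c∣)

  p^∣cross : ∀ {k l} a b c → p^ a ∣ K k → p^ b ∣ K l → p^ c ∣ + k - + l → p^ (a ℕ.+ b ℕ.+ c) ∣ cross k l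
  p^∣cross {k} {l} a b c p^a∣ p^b∣ p^c∣ = subst (p^ (a ℕ.+ b ℕ.+ c) ∣_)
    (solve 2 (λ x y → (x :- y) :+ y := x) refl (cross k l) (u * (K k * K l * (+ k - + l))))
    (∣m∣n⇒∣m+n (p^-weaken (ℕ.n≤1+n (a ℕ.+ b ℕ.+ c)) (cross-leading {k} {l} a b c p^a∣ p^b∣ p^c∣))
      (u*product {k} {l} a b c p^a∣ p^b∣ p^c∣))

  -- Converse of `p^∣cross`, by induction on c: knowing that pᶜ divides k - l makes the error in
  -- `cross-leading` divisible by one more power, so the main term u · K k · K l · (k - l), and with
  -- it k - l, gains that power.
  difference-from-cross : ∀ {k l a b} → a ∥ K k → b ∥ K l →
                          ∀ c → p^ (a ℕ.+ b ℕ.+ c) ∣ cross k l → p^ c ∣ + k - + l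
  difference-from-cross {k} {l} _ _ zero _ = divides (+ k - + l) (sym (ℤ.*-identityʳ (+ k - + l)))
  difference-from-cross {k} {l} {a} {b} a∥ b∥ (suc c) e =
    ∥-cancel {b} {K l} (suc c) b∥ (∥-cancel {a} {K k} (b ℕ.+ suc c) a∥ (unit-cancel (a ℕ.+ (b ℕ.+ suc c)) p∤u
      (subst₂ (λ n x → p^ n ∣ x) (ℕ.+-assoc a b (suc c))
        (solve 5 (λ u a b e x → x :- (x :- u :* (a :* b :* e)) := u :* (a :* (b :* e))) refl
          u (K k) (K l) (+ k - + l) (cross k l))
        (∣m∣n⇒∣m-n e (subst (λ n → p^ n ∣ cross k l - u * (K k * K l * (+ k - + l)))
          (sym (ℕ.+-suc (a ℕ.+ b) c))
          (cross-leading {k} {l} a b c (proj₁ a∥) (proj₁ b∥) ih))))))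
    where
    ih : p^ c ∣ + k - + l
    ih = difference-from-cross {k} {l} {a} {b} a∥ b∥ c (p^-weaken (ℕ.+-monoʳ-≤ (a ℕ.+ b) (ℕ.n≤1+n c)) e)

  r-difference : ∀ k l → (+ k - r) - (+ l - r) ≡ + k - + l
  r-difference k l = solve 3 (λ k l r → (k :- r) :- (l :- r) := k :- l) refl (+ k) (+ l) r

  p^∣k-r⇒p^∣K : ∀ {k} a → p^ a ∣ + k - r → p^ a ∣ K k
  p^∣k-r⇒p^∣K {k} a e = subst (p^ a ∣_) (sym (pronic-factors (+ k))) (∣m⇒∣m*n (+ k - s) e)

  p^∣k-s⇒p^∣K : ∀ {k} a → p^ a ∣ + k - s → p^ a ∣ K k
  p^∣k-s⇒p^∣K {k} a e = subst (p^ a ∣_) (sym (pronic-factors (+ k))) (∣n⇒∣m*n (+ k - r) e)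

  p^∣K⇒p^∣k-r : ∀ {k} a → + p ∣ + k - r → p^ a ∣ K k → p^ a ∣ + k - r
  p^∣K⇒p^∣k-r {k} a p∣k-r e = unit-cancel a p∤k-s (subst (p^ a ∣_)
    (trans (pronic-factors (+ k)) (ℤ.*-comm (+ k - r) (+ k - s))) e)
    where
    p∤k-s : ¬ + p ∣ + k - s
    p∤k-s p∣k-s = p∤r-s (subst (+ p ∣_)
      (solve 3 (λ k r s → (k :- s) :- (k :- r) := r :- s) refl (+ k) r s) (∣m∣n⇒∣m-n p∣k-s p∣k-r))

  p^∣K⇒p^∣k-s : ∀ {k} a → ¬ + p ∣ + k - r → p^ a ∣ K k → p^ a ∣ + k - s
  p^∣K⇒p^∣k-s {k} a p∤k-r e = unit-cancel a p∤k-r (subst (p^ a ∣_) (pronic-factors (+ k)) e)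

  near-s : ∀ {k n} → 1 ℕ.≤ n → p^ n ∣ + k - s → p^ n ∣ defect k
  near-s {k} {suc n} _ e = proj₂ (away-from-r p∤k-r (suc n)) (p^∣k-s⇒p^∣K {k} (suc n) e)
    where
    p∤k-r : ¬ + p ∣ + k - r
    p∤k-r p∣k-r = p∤r-s (subst (+ p ∣_)
      (solve 3 (λ k r s → (k :- s) :- (k :- r) := r :- s) refl (+ k) r s)
      (∣m∣n⇒∣m-n (p^suc∣⇒p∣ {n} e) p∣k-r))

  away-fixed : ∀ {k n} → ¬ + p ∣ + k - r → p^ n ∣ defect k → p^ n ∣ + k - s
  away-fixed {k} {n} p∤k-r e = p^∣K⇒p^∣k-s {k} n p∤k-r (proj₁ (away-from-r p∤k-r n) e)

  -- Two balls, around r and around a fixed point l.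

  module TwoRoots {n v l} (p^n∣l : p^ n ∣ defect l) (v∥Kl : v ∥ K l) (2v<n : 2 ℕ.* v ℕ.< n) where

    v+v<n : v ℕ.+ v ℕ.< n
    v+v<n = subst (ℕ._< n) (cong (v ℕ.+_) (ℕ.+-identityʳ v)) 2v<n

    -- In each of the two balls one of v(k - r), v(k - l) equals v, and the other has to supply the
    -- remaining n - v.
    e : ℕ
    e = n ℕ.∸ v

    v+e≡n : v ℕ.+ e ≡ n
    v+e≡n = ℕ.m+[n∸m]≡n (ℕ.≤-trans (ℕ.m≤m+n v v) (ℕ.<⇒≤ v+v<n))

    v<e : v ℕ.< e
    v<e = ℕ.+-cancelˡ-< v v e (subst (v ℕ.+ v ℕ.<_) (sym v+e≡n) v+v<n)

    -- Off the class of r the defect of l would have the same valuation as K l, namely v < n.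
    p∣l-r : + p ∣ + l - r
    p∣l-r with + p ∣? + l - r
    ... | yes p∣l-r = p∣l-r
    ... | no  p∤l-r = contradiction
      (∥-unique-≤ {v} {n} v∥Kl (proj₁ (away-from-r p∤l-r n) p^n∣l))
      (ℕ.<⇒≱ (ℕ.≤-<-trans (ℕ.m≤m+n v v) v+v<n))

    p^v∣l-r : p^ v ∣ + l - r
    p^v∣l-r = p^∣K⇒p^∣k-r {l} v p∣l-r (proj₁ v∥Kl)

    -- Both summands of K l · defect k = cross k l + K k · defect l are divisible by p^(v+n), and K
    -- l accounts for only v of these factors.
    via-cross : ∀ {k} a c → a ℕ.+ c ≡ n → v ℕ.≤ a → p^ a ∣ K k → p^ c ∣ + k - + l → p^ n ∣ defect k
    via-cross {k} a c a+c≡n v≤a p^a∣K p^c∣ = ∥-cancel {v} {K l} n v∥Kl (subst (p^ (v ℕ.+ n) ∣_)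
      (solve 2 (λ x y → (x :- y) :+ y := x) refl (K l * defect k) (K k * defect l))
      (∣m∣n⇒∣m+n
        (subst (λ j → p^ j ∣ cross k l) a+v+c≡v+n (p^∣cross {k} {l} a v c p^a∣K (proj₁ v∥Kl) p^c∣))
        (*-pres-p^∣ {v} {n} (p^-weaken v≤a p^a∣K) p^n∣l)))
      where
      a+v+c≡v+n : a ℕ.+ v ℕ.+ c ≡ v ℕ.+ n
      a+v+c≡v+n = trans (cong (ℕ._+ c) (ℕ.+-comm a v)) (trans (ℕ.+-assoc v a c) (cong (v ℕ.+_) a+c≡n))

    near-r : ∀ {k} → p^ e ∣ + k - r → p^ n ∣ defect k
    near-r {k} p^e∣k-r = via-cross {k} e v (trans (ℕ.+-comm e v) v+e≡n) (ℕ.<⇒≤ v<e)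
      (p^∣k-r⇒p^∣K {k} e p^e∣k-r) (subst (p^ v ∣_) (r-difference k l)
        (∣m∣n⇒∣m-n (p^-weaken (ℕ.<⇒≤ v<e) p^e∣k-r) p^v∣l-r))

    near-l : ∀ {k} → p^ e ∣ + k - + l → p^ n ∣ defect k
    near-l {k} p^e∣k-l = via-cross {k} v e v+e≡n ℕ.≤-refl (p^∣k-r⇒p^∣K {k} v (subst (p^ v ∣_)
      (solve 3 (λ k l r → (k :- l) :+ (l :- r) := k :- r) refl (+ k) (+ l) r)
      (∣m∣n⇒∣m+n (p^-weaken (ℕ.<⇒≤ v<e) p^e∣k-l) p^v∣l-r))) p^e∣k-l

    -- With both defects divisible by pⁿ and both K k and K l by pᵇ, the cross difference is
    -- divisible by p^(b+n); `difference-from-cross` turns this into closeness of k and l.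
    difference-bound : ∀ {k a} → p^ n ∣ defect k → a ∥ K k → ∀ b c → b ℕ.≤ a → b ℕ.≤ v →
                       a ℕ.+ v ℕ.+ c ≡ b ℕ.+ n → p^ c ∣ + k - + l
    difference-bound {k} {a} p^n∣k a∥ b c b≤a b≤v eq = difference-from-cross {k} {l} {a} {v} a∥ v∥Kl c
      (subst (λ j → p^ j ∣ cross k l) (sym eq) (∣m∣n⇒∣m-n
        (*-pres-p^∣ {b} {n} (p^-weaken b≤v (proj₁ v∥Kl)) p^n∣k)
        (*-pres-p^∣ {b} {n} (p^-weaken b≤a (proj₁ a∥)) p^n∣l)))

    fixed-near-r : ∀ {k} → + p ∣ + k - r → p^ n ∣ defect k → p^ e ∣ + k - r ⊎ p^ e ∣ + k - + l
    fixed-near-r {k} p∣k-r p^n∣k with ∣⊎∥ e (K k)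
    ... | inj₁ p^e∣K = inj₁ (p^∣K⇒p^∣k-r {k} e p∣k-r p^e∣K)
    ... | inj₂ (a , a<e , a∥) with a ℕ.≤? v
    ... | yes a≤v = inj₂ (difference-bound {k} {a} p^n∣k a∥ a e ℕ.≤-refl a≤v
                      (trans (ℕ.+-assoc a v e) (cong (a ℕ.+_) v+e≡n)))
    -- For v < a < e both k - r and k - l would be divisible by p^(v+1), the latter because n - a >
    -- v. Then so would l - r, against v(K l) = v.
    ... | no  a≰v = contradiction (∥-unique-≤ {v} {suc v} v∥Kl (p^∣k-r⇒p^∣K {l} (suc v) p^v+1∣l-r))
                      (ℕ.<⇒≱ ℕ.≤-refl)
      where
      c : ℕ
      c = n ℕ.∸ a
      a+c≡n : a ℕ.+ c ≡ n
      a+c≡n = ℕ.m+[n∸m]≡n (ℕ.≤-trans (ℕ.<⇒≤ a<e) (ℕ.m∸n≤m n v))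
      v<c : v ℕ.< c
      v<c = ℕ.+-cancelˡ-< a v c (subst₂ ℕ._<_ (ℕ.+-comm v a) (trans v+e≡n (sym a+c≡n)) (ℕ.+-monoʳ-< v a<e))
      p^v+1∣l-r : p^ (suc v) ∣ + l - r
      p^v+1∣l-r = subst (p^ (suc v) ∣_)
        (solve 3 (λ k l r → (k :- r) :- (k :- l) := l :- r) refl (+ k) (+ l) r)
        (∣m∣n⇒∣m-n (p^-weaken (ℕ.≰⇒> a≰v) (p^∣K⇒p^∣k-r {k} a p∣k-r (proj₁ a∥)))
          (p^-weaken v<c (difference-bound {k} {a} p^n∣k a∥ v c (ℕ.<⇒≤ (ℕ.≰⇒> a≰v)) ℕ.≤-refl
            (trans (cong (ℕ._+ c) (ℕ.+-comm a v)) (trans (ℕ.+-assoc v a c) (cong (v ℕ.+_) a+c≡n))))))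

    to : ∀ k → p^ n ∣ defect k → (p^ e ∣ + k - r ⊎ p^ e ∣ + k - + l) ⊎ p^ n ∣ + k - s
    to k p^n∣k with + p ∣? + k - r
    ... | yes p∣k-r = inj₁ (fixed-near-r p∣k-r p^n∣k)
    ... | no  p∤k-r = inj₂ (away-fixed {k} {n} p∤k-r p^n∣k)

    from : ∀ k → (p^ e ∣ + k - r ⊎ p^ e ∣ + k - + l) ⊎ p^ n ∣ + k - s → p^ n ∣ defect k
    from k (inj₁ (inj₁ x)) = near-r x
    from k (inj₁ (inj₂ x)) = near-l x
    from k (inj₂ x)        = near-s (ℕ.≤-trans (s≤s z≤n) 2v<n) x

  K≢0 : ∀ {l} → 2 ℕ.≤ l → K l ≢ 0ℤ
  K≢0 {suc (suc l)} _ ()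
  K≢0 {suc zero} (s≤s ())

  -- Newton iteration for the zero of b.

  -- The value b(l) = defect l / K l is divisible by pᵗ, so l approximates the zero of b.
  ApproximateRoot : ℕ → ℕ → Set
  ApproximateRoot t l = 2 ℕ.≤ l × + p ∣ + l - r × ∃ λ a → a ∥ K l × p^ (a ℕ.+ t) ∣ defect l

  initial-root : ∀ {l} → 2 ℕ.≤ l → + p ∣ + l - r → ApproximateRoot 1 l
  initial-root {l} 2≤l p∣l-r with ∃-∥ (K≢0 2≤l)
  ... | a , a∥K = 2≤l , p∣l-r , a , a∥K , subst (λ j → p^ j ∣ defect l) (ℕ.+-comm 1 a)
    (gains-one {l} {a} p∣l-r (proj₁ a∥K))

  -- One Newton step l′ = l + τ p^(t+1). Up to higher order b(l′) = b(l) + u (l′ - l); with K l = K₀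
  -- pᵃ and defect l = f₀ p^(a+t+1), the digit τ has to satisfy f₀ + u K₀ τ ≡ 0 modulo p.
  improve-root : ∀ {t l} → ApproximateRoot (suc t) l → ∃ (ApproximateRoot (suc (suc t)))
  improve-root {t} {l} (2≤l , p∣l-r , a , a∥K@(divides K₀ K≡ , p^a+1∤K) , divides f₀ f≡) =
    l′ , 2≤l′ , p∣l′-r , a′ , a′∥K′ , ∥-cancel {a} {K l} (a′ ℕ.+ suc (suc t)) a∥K
      (subst₂ (λ j x → p^ j ∣ x) exponent
        (solve 3 (λ x y z → (x :- y :- z) :+ (y :+ z) := x) refl
          (K l * defect l′) (K l′ * defect l) (u * (K l′ * K l * (+ l′ - + l))))
        (∣m∣n⇒∣m+n leading corrected))
    where
    p∤K₀ : ¬ + p ∣ K₀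
    p∤K₀ (divides K₁ refl) = p^a+1∤K (divides K₁ (trans K≡ (trans (ℤ.*-assoc K₁ (+ p) (p^ a))
      (cong (K₁ *_) (sym (p^-suc a))))))

    correction : ∃ λ τ → + p ∣ f₀ + u * K₀ * + τ
    correction = solve-linear (p∤* p∤u p∤K₀) f₀

    τ l′ : ℕ
    τ = proj₁ correction
    l′ = l ℕ.+ τ ℕ.* p ℕ.^ suc t

    l′-l≡ : + l′ - + l ≡ + τ * p^ (suc t)
    l′-l≡ = trans (cong (λ x → + l + x - + l) (ℤ.pos-* τ (p ℕ.^ suc t)))
      (solve 2 (λ x y → x :+ y :- x := y) refl (+ l) (+ τ * p^ (suc t)))

    p^t+1∣l′-l : p^ (suc t) ∣ + l′ - + l
    p^t+1∣l′-l = divides (+ τ) l′-l≡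

    2≤l′ : 2 ℕ.≤ l′
    2≤l′ = ℕ.≤-trans 2≤l (ℕ.m≤m+n l _)

    p∣l′-r : + p ∣ + l′ - r
    p∣l′-r = subst (+ p ∣_) (solve 3 (λ k l r → (k :- l) :+ (l :- r) := k :- r) refl (+ l′) (+ l) r)
      (∣m∣n⇒∣m+n (p^suc∣⇒p∣ {t} p^t+1∣l′-l) p∣l-r)

    -- The valuation of K may change from l to l′, so it is determined afresh.
    a′ : ℕ
    a′ = proj₁ (∃-∥ (K≢0 2≤l′))
    a′∥K′ : a′ ∥ K l′
    a′∥K′ = proj₂ (∃-∥ (K≢0 2≤l′))

    leading : p^ (suc (a′ ℕ.+ a ℕ.+ suc t)) ∣ cross l′ l - u * (K l′ * K l * (+ l′ - + l))
    leading = cross-leading {l′} {l} a′ a (suc t) (proj₁ a′∥K′) (proj₁ a∥K) p^t+1∣l′-l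

    corrected : p^ (suc (a′ ℕ.+ a ℕ.+ suc t)) ∣ K l′ * defect l + u * (K l′ * K l * (+ l′ - + l))
    corrected = subst₂ (λ j x → p^ j ∣ x)
      (trans (ℕ.+-suc a′ (a ℕ.+ suc t)) (cong suc (sym (ℕ.+-assoc a′ a (suc t)))))
      (trans (solve 7 (λ k f u k₀ τ p^a p^t →
            k :* ((f :+ u :* k₀ :* τ) :* (p^a :* p^t))
            := k :* (f :* (p^a :* p^t)) :+ u :* (k :* (k₀ :* p^a) :* (τ :* p^t))) refl
          (K l′) f₀ u K₀ (+ τ) (p^ a) (p^ (suc t)))
        (sym (trans (cong₂ (λ x y → K l′ * x + u * (K l′ * y * (+ l′ - + l)))
            (trans f≡ (cong (f₀ *_) (p^-+ a (suc t)))) K≡)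
          (cong (λ x → K l′ * (f₀ * (p^ a * p^ (suc t))) + u * (K l′ * (K₀ * p^ a) * x)) l′-l≡))))
      (*-pres-p^∣ {a′} {suc (a ℕ.+ suc t)} (proj₁ a′∥K′)
        (*-pres-p^∣ {1} {a ℕ.+ suc t} (p∣⇒p^1∣ (proj₂ correction))
          (∣-reflexive (p^-+ a (suc t)))))

    exponent : suc (a′ ℕ.+ a ℕ.+ suc t) ≡ a ℕ.+ (a′ ℕ.+ suc (suc t))
    exponent = trans (cong (λ x → suc (x ℕ.+ suc t)) (ℕ.+-comm a′ a))
      (trans (cong suc (ℕ.+-assoc a a′ (suc t))) (trans (sym (ℕ.+-suc a (a′ ℕ.+ suc t)))
      (cong (a ℕ.+_) (sym (ℕ.+-suc a′ (suc t))))))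

  approximate-root : ∀ {l} → 2 ℕ.≤ l → + p ∣ + l - r → ∀ t → ∃ (ApproximateRoot (suc t))
  approximate-root 2≤l p∣l-r zero    = _ , initial-root 2≤l p∣l-r
  approximate-root 2≤l p∣l-r (suc t) = improve-root (proj₂ (approximate-root 2≤l p∣l-r t))

  -- A single ball around r.

  module OneCluster {n c l₀} (1≤n : 1 ℕ.≤ n) (n≤2c : n ℕ.≤ c ℕ.+ c)
    (2≤l₀ : 2 ℕ.≤ l₀) (p∣l₀-r : + p ∣ + l₀ - r)
    (minimal : ∀ {k a} → p^ n ∣ defect k → a ∥ K k → a ≢ 0 → c ℕ.≤ a) where

    p∣K⇒≢0 : ∀ {k a} → + p ∣ + k - r → a ∥ K k → a ≢ 0
    p∣K⇒≢0 {k} p∣k-r (_ , p∤K) refl = p∤K (p^∣k-r⇒p^∣K {k} 1 (p∣⇒p^1∣ p∣k-r))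

    -- An approximate root l of precision n + 1 has a defect divisible by pⁿ, so minimality puts it
    -- within pᶜ of r. For k in that ball both K k and k - l are divisible by pᶜ, and 2 c ≥ n.
    near-r : ∀ {k} → p^ c ∣ + k - r → p^ n ∣ defect k
    near-r {k} p^c∣k-r with approximate-root 2≤l₀ p∣l₀-r n
    ... | l , 2≤l , p∣l-r , b , b∥K , p^b+n+1∣f = ∥-cancel {b} {K l} n b∥K (subst (p^ (b ℕ.+ n) ∣_)
      (solve 2 (λ x y → (x :- y) :+ y := x) refl (K l * defect k) (K k * defect l))
      (∣m∣n⇒∣m+n
        (p^-weaken (ℕ.≤-trans (ℕ.+-monoʳ-≤ b n≤2c) (ℕ.≤-reflexive
            (trans (sym (ℕ.+-assoc b c c)) (cong (ℕ._+ c) (ℕ.+-comm b c)))))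
          (p^∣cross {k} {l} c b c (p^∣k-r⇒p^∣K {k} c p^c∣k-r) (proj₁ b∥K)
            (subst (p^ c ∣_) (r-difference k l) (∣m∣n⇒∣m-n p^c∣k-r p^c∣l-r))))
        (∣n⇒∣m*n (K k) p^b+n∣f)))
      where
      p^b+n∣f : p^ (b ℕ.+ n) ∣ defect l
      p^b+n∣f = p^-weaken (ℕ.+-monoʳ-≤ b (ℕ.n≤1+n n)) p^b+n+1∣f
      p^c∣l-r : p^ c ∣ + l - r
      p^c∣l-r = p^∣K⇒p^∣k-r {l} c p∣l-r (p^-weaken
        (minimal {l} {b} (p^-weaken (ℕ.m≤n+m n b) p^b+n∣f) b∥K (p∣K⇒≢0 {l} {b} p∣l-r b∥K)) (proj₁ b∥K))

    to : ∀ k → p^ n ∣ defect k → p^ c ∣ + k - r ⊎ p^ n ∣ + k - s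
    to k p^n∣k with + p ∣? + k - r
    ... | no  p∤k-r = inj₂ (away-fixed {k} {n} p∤k-r p^n∣k)
    ... | yes p∣k-r with ∣⊎∥ c (K k)
    ... | inj₁ p^c∣K = inj₁ (p^∣K⇒p^∣k-r {k} c p∣k-r p^c∣K)
    ... | inj₂ (a , a<c , a∥K) = contradiction
      (minimal {k} {a} p^n∣k a∥K (p∣K⇒≢0 {k} {a} p∣k-r a∥K)) (ℕ.<⇒≱ a<c)

    from : ∀ k → p^ c ∣ + k - r ⊎ p^ n ∣ + k - s → p^ n ∣ defect k
    from k (inj₁ x) = near-r x
    from k (inj₂ x) = near-s 1≤n x

-- Counting residue classes.

module Counting where

  open import Data.Integer.Base using (+_; _+_; _*_; _-_; -_; _%ℕ_; _/ℕ_)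
  open import Data.Integer.Divisibility.Signed
  open +-*-Solver

  -- Representatives are natural numbers, so counting takes place without p-adic integers;
  -- `count⇒cardinality` returns to these.
  record Count (m : ℕ) (P : ℕ → Set) (c : ℕ) : Set where
    field
      element   : Fin c → ℕ
      sound     : ∀ i → P (element i)
      injective : ∀ {i j} → + element i ≡ + element j [mod m ] → i ≡ j
      complete  : ∀ {k} → P k → ∃ λ i → + element i ≡ + k [mod m ]

  open Count

  multiple<⇒0 : ∀ {m k} → k ℕ.< m → m ℕ.∣ k → k ≡ 0
  multiple<⇒0 {k = zero}  _   _   = refl
  multiple<⇒0 {k = suc k} k<m m∣k = contradiction (ℕ.∣⇒≤ m∣k) (ℕ.<⇒≱ k<m)

  residues-unique : ∀ {m k l} → k ℕ.< m → l ℕ.< m → + m ∣ + k - + l → k ≡ l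
  residues-unique {m} {k} {l} k<m l<m m∣k-l = ℤ.+-injective (ℤ.i-j≡0⇒i≡j (+ k) (+ l)
    (ℤ.∣i∣≡0⇒i≡0 (multiple<⇒0 (ℕ.≤-<-trans
      (ℕ.≤-trans (ℕ.≤-reflexive (cong ℤ.∣_∣ (ℤ.m-n≡m⊖n k l))) (ℤ.∣m⊝n∣≤m⊔n k l))
      (ℕ.⊔-pres-<m k<m l<m)) (∣⇒∣ᵤ m∣k-l))))

  count-class : ∀ e f .{{_ : ℕ.NonZero e}} .{{_ : ℕ.NonZero f}} r →
                Count (e ℕ.* f) (λ k → + e ∣ + k - + r) f
  count-class e f r .element i = r ℕ.+ toℕ i ℕ.* e
  count-class e f r .sound i = divides (+ toℕ i)
    (trans (cong (λ x → + r + x - + r) (ℤ.pos-* (toℕ i) e))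
      (solve 2 (λ r x → r :+ x :- r := x) refl (+ r) (+ toℕ i * + e)))
  count-class e f r .injective {i} {j} (mod d) = Fin.toℕ-injective
    (residues-unique (Fin.toℕ<n i) (Fin.toℕ<n j) (*-cancelˡ-∣ (+ e) (subst₂ _∣_ (ℤ.pos-* e f)
      (trans (cong₂ (λ x y → (+ r + x) - (+ r + y)) (ℤ.pos-* (toℕ i) e) (ℤ.pos-* (toℕ j) e))
        (solve 4 (λ r i j e → (r :+ i :* e) :- (r :+ j :* e) := e :* (i :- j)) refl
          (+ r) (+ toℕ i) (+ toℕ j) (+ e)))
      d)))
  -- With k - r = t e, the index is t modulo f; the quotient t / f only shifts by multiples of e f.
  count-class e f r .complete {k} (divides t k-r≡te) = Fin.fromℕ< i<f , mod (divides (- (t /ℕ f))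
    (trans (cong (λ x → + (r ℕ.+ x ℕ.* e) - + k) (Fin.toℕ-fromℕ< i<f))
    (trans (cong (λ x → + r + x - + k) (ℤ.pos-* (t %ℕ f) e))
    (trans (solve 3 (λ r x k → r :+ x :- k := x :- (k :- r)) refl (+ r) (+ (t %ℕ f) * + e) (+ k))
    (trans (cong (λ x → + (t %ℕ f) * + e - x) k-r≡te)
    (trans (cong (λ x → + (t %ℕ f) * + e - x * + e) (ℤ.a≡a%ℕn+[a/ℕn]*n t f))
    (trans (solve 4 (λ i q e f → i :* e :- (i :+ q :* f) :* e := :- q :* (e :* f)) refl
      (+ (t %ℕ f)) (t /ℕ f) (+ e) (+ f))
    (cong (- (t /ℕ f) *_) (sym (ℤ.pos-* e f))))))))))
    where
    i<f : t %ℕ f ℕ.< f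
    i<f = ℤ.n%ℕd<d t f

  -- Disjointness is required of the residue classes: disjoint predicates could still meet a common
  -- class.
  count-⊎ : ∀ {m P Q a b} → (∀ {k l} → P k → Q l → ¬ + k ≡ + l [mod m ]) →
            Count m P a → Count m Q b → Count m (λ k → P k ⊎ Q k) (a ℕ.+ b)
  count-⊎ {m} {P} {Q} {a} {b} disjoint A B = record
    { element   = from ∘ Fin.splitAt a
    ; sound     = λ i → sound′ (Fin.splitAt a i)
    ; injective = λ {i} {j} e → trans (sym (Fin.join-splitAt a b i))
        (trans (cong (Fin.join a b) (injective′ (Fin.splitAt a i) (Fin.splitAt a j) e)) (Fin.join-splitAt a b j))
    ; complete  = complete′
    }
    where
    from : Fin a ⊎ Fin b → ℕ
    from = [ element A , element B ]

    sound′ : ∀ x → P (from x) ⊎ Q (from x)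
    sound′ (inj₁ i) = inj₁ (sound A i)
    sound′ (inj₂ i) = inj₂ (sound B i)

    injective′ : ∀ x y → + from x ≡ + from y [mod m ] → x ≡ y
    injective′ (inj₁ i) (inj₁ j) e = cong inj₁ (injective A e)
    injective′ (inj₁ i) (inj₂ j) e = contradiction e (disjoint (sound A i) (sound B j))
    injective′ (inj₂ i) (inj₁ j) e = contradiction (mod-sym e) (disjoint (sound A j) (sound B i))
    injective′ (inj₂ i) (inj₂ j) e = cong inj₂ (injective B e)

    complete′ : ∀ {k} → P k ⊎ Q k → ∃ λ i → + from (Fin.splitAt a i) ≡ + k [mod m ]
    complete′ {k} (inj₁ pk) with complete A pk
    ... | i , e = i Fin.↑ˡ b , subst (λ x → + from x ≡ + k [mod m ]) (sym (Fin.splitAt-↑ˡ a i b)) e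
    complete′ {k} (inj₂ qk) with complete B qk
    ... | i , e = a Fin.↑ʳ i , subst (λ x → + from x ≡ + k [mod m ]) (sym (Fin.splitAt-↑ʳ a b i)) e

  count-⇔ : ∀ {m P Q c} → (∀ k → P k → Q k) → (∀ k → Q k → P k) → Count m P c → Count m Q c
  count-⇔ to from A = record
    { element   = element A
    ; sound     = λ i → to _ (sound A i)
    ; injective = injective A
    ; complete  = λ qk → complete A (from _ qk)
    }

-- Passage from p-adic integers to integer approximations.

module PAdic {p : ℕ} {{p-prime : Prime p}} where

  open import Data.Integer.Base using (ℤ; +_; _+_; _-_; -_; 1ℤ)
  open import Data.Integer.Divisibility.Signed
  open +-*-Solver
  open PrimePowers p-prime
  open IteratedSums using (pronic)

  ≡mod⇒∣ : ∀ {m a b} → a ≡ b [mod m ] → + m ∣ a → + m ∣ b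
  ≡mod⇒∣ {m} {a} {b} (mod e) m∣a = subst (+ m ∣_)
    (solve 2 (λ a b → a :- (a :- b) := b) refl a b) (∣m∣n⇒∣m-n m∣a e)

  approx-coherent : ∀ x {v n} → v ℕ.≤ n → approx x n ≡ approx x v [mod p ℕ.^ v ]
  approx-coherent x {v} {n} v≤n = subst (λ j → approx x j ≡ approx x v [mod p ℕ.^ v ])
    (ℕ.m∸n+n≡m v≤n) (D.coherent-+ x (n ℕ.∸ v) v)

  ∣⇒∣approx : ∀ {x v n} → v ℕ.≤ n → (D.p^ v) D.∣ x → p^ v ∣ approx x n
  ∣⇒∣approx {x} {v} v≤n (w RawMagma., wpᵛ≈x) = ≡mod⇒∣ (mod-sym (approx-coherent x v≤n))
    (≡mod⇒∣ (at wpᵛ≈x v) (divides (approx w v) refl))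

  ∣approx⇒∣ : ∀ {x v n} → v ℕ.≤ n → p^ v ∣ approx x n → (D.p^ v) D.∣ x
  ∣approx⇒∣ {x} {v} {n} v≤n pᵛ∣xₙ with D.approx⇒mod-p^ {x = x} {y = D.0#} v
    (mod (subst (p^ v ∣_) (sym (ℤ.+-identityʳ (approx x v))) (≡mod⇒∣ (approx-coherent x v≤n) pᵛ∣xₙ)))
  ... | w RawMagma., equal wpᵛ≈x-0 = w RawMagma., equal λ k →
    mod-trans (wpᵛ≈x-0 k) (mod-reflexive (ℤ.+-identityʳ (approx x k)))

  -- The strict inequality makes level n fine enough to detect that p^(v+1) does not divide x.
  valuation⇒∥ : ∀ {x v n} → v ℕ.< n → HasValuation x v → v ∥ approx x n
  valuation⇒∥ v<n (pᵛ∣x , pᵛ⁺¹∤x) = ∣⇒∣approx (ℕ.<⇒≤ v<n) pᵛ∣x , λ e → pᵛ⁺¹∤x (∣approx⇒∣ v<n e)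

  ∥⇒valuation-pronic : ∀ {k v} → v ∥ pronic (+ k) → HasValuation (fromℤ (+ k) D.* (fromℤ (+ k) D.- D.1#)) v
  ∥⇒valuation-pronic {v = v} (pᵛ∣ , pᵛ⁺¹∤) = ∣approx⇒∣ {n = v} ℕ.≤-refl pᵛ∣ ,
    λ e → pᵛ⁺¹∤ (∣⇒∣approx {n = suc v} ℕ.≤-refl e)

  pronic-cong : ∀ {m a b} → a ≡ b [mod m ] → pronic a ≡ pronic b [mod m ]
  pronic-cong a≡b = D.mod-* a≡b (D.mod-+ a≡b mod-refl)

  valuation⇒∥-pronic : ∀ {z v n k} → v ℕ.< n → + k ≡ approx z n [mod p ℕ.^ n ] →
                       HasValuation (z D.* (z D.- D.1#)) v → v ∥ pronic (+ k)
  valuation⇒∥-pronic {z} {v} {n} {k} v<n k≡z val with valuation⇒∥ {n = n} v<n val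
  ... | pᵛ∣ , pᵛ⁺¹∤ =
    ≡mod⇒∣ (D.mod-weaken (∣⇒∣ᵤ (p^-mono-∣ (ℕ.<⇒≤ v<n))) (mod-sym K≡)) pᵛ∣ ,
    λ e → pᵛ⁺¹∤ (≡mod⇒∣ (D.mod-weaken (∣⇒∣ᵤ (p^-mono-∣ v<n)) K≡) e)
    where
    K≡ : pronic (+ k) ≡ pronic (approx z n) [mod p ℕ.^ n ]
    K≡ = pronic-cong k≡z

  module FixedPoints (q : ℤₚ p) (q∈U : q ∈U 1) (n : ℕ) where

    -- The modulus is p^(n+1), the n of the theorem being n + 1 here, and d represents q - 1 to that
    -- precision.
    d : ℤ
    d = approx q (suc n) - 1ℤ

    1+d≡q : 1ℤ + d ≡ approx q (suc n)
    1+d≡q = solve 1 (λ x → con 1ℤ :+ (x :- con 1ℤ) := x) refl (approx q (suc n))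

    Fixed : ℕ → Set
    Fixed k = p^ (suc n) ∣ geomℤ (1ℤ + d) k - + k

    ι≡geomℤ : ∀ {z k} → + k ≡ approx z (suc n) [mod p ℕ.^ suc n ] →
              approx (D.ι q q∈U z) (suc n) ≡ geomℤ (1ℤ + d) k [mod p ℕ.^ suc n ]
    ι≡geomℤ {z} {k} k≡z = mod-trans (D.geom-approx q (residue z (suc n)) (suc n))
      (mod-trans (D.geomℤ-cong-exponent (suc n) (residue z (suc n)) k (D.∈U⇒approx≡1 q∈U n)
        (mod-trans (residue-≡ z (suc n)) (mod-sym k≡z)))
      (mod-reflexive (cong (λ x → geomℤ x k) (sym 1+d≡q))))

    fixed⇒ : ∀ {z k} → + k ≡ approx z (suc n) [mod p ℕ.^ suc n ] → ModularFixedPoint q q∈U (suc n) z → Fixed k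
    fixed⇒ {z} k≡z e = divides-difference (mod-trans (mod-sym (ι≡geomℤ {z} k≡z))
      (mod-trans (D.mod-p^⇒approx (suc n) e) (mod-sym k≡z)))

    fixed⇐ : ∀ {z k} → + k ≡ approx z (suc n) [mod p ℕ.^ suc n ] → Fixed k → ModularFixedPoint q q∈U (suc n) z
    fixed⇐ {z} k≡z e = D.approx⇒mod-p^ (suc n) (mod-trans (ι≡geomℤ {z} k≡z) (mod-trans (mod e) k≡z))

    count⇒cardinality : ∀ {c} → Counting.Count (p ℕ.^ suc n) Fixed c →
                        HasCardinality (ModularFixedPoints q q∈U (suc n)) c
    count⇒cardinality A = record
      { to        = λ i → fromℤ (+ element i) , fixed⇐ mod-refl (sound i)
      ; cong      = λ { refl → D.approx⇒mod-p^ (suc n) mod-refl }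
      ; bijective = (λ e → injective (D.mod-p^⇒approx (suc n) e)) ,
                    λ { (z , z-fixed) → surjective z (complete (fixed⇒ (residue-≡ z (suc n)) z-fixed)) }
      }
      where
      open Counting.Count A
      surjective : ∀ z → (∃ λ i → + element i ≡ + residue z (suc n) [mod p ℕ.^ suc n ]) →
                   ∃ λ i → ∀ {j} → j ≡ i → fromℤ (+ element j) D.≡ z [mod-p^ suc n ]
      surjective z (i , e) = i , λ { refl → D.approx⇒mod-p^ (suc n) (mod-trans e (residue-≡ z (suc n))) }

    all-fixed : q D.≡ D.1# [mod-p^ suc n ] → ∀ z → ModularFixedPoint q q∈U (suc n) z
    all-fixed q≡1 z = fixed⇐ (residue-≡ z (suc n)) (divides-difference (D.geomℤ-≡1 (residue z (suc n))
      (mod-trans (mod-reflexive 1+d≡q) (D.mod-p^⇒approx (suc n) q≡1))))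

    smallest⇒minimal : ∀ {v} → IsSmallestNonzeroValuation q q∈U (suc n) v →
                       ∀ {k a} → Fixed k → a ∥ pronic (+ k) → a ≢ 0 → v ℕ.≤ a
    smallest⇒minimal (_ , _ , least) {k} {a} k-fixed a∥ =
      least (fromℤ (+ k)) a (fixed⇐ mod-refl k-fixed) (∥⇒valuation-pronic {k} {a} a∥)

    smallest⇒attained : ∀ {v} → v ℕ.< suc n → IsSmallestNonzeroValuation q q∈U (suc n) v →
                        ∃ λ k → Fixed k × v ∥ pronic (+ k)
    smallest⇒attained v<n (_ , (z , z-fixed , val) , _) =
      residue z (suc n) , fixed⇒ (residue-≡ z (suc n)) z-fixed ,
      valuation⇒∥-pronic v<n (residue-≡ z (suc n)) val

    module _ {m} (q≢1 : ¬ q D.≡ D.1# [mod-p^ suc n ]) (val : HasValuation (q D.- D.1#) m) where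

      m<n : m ℕ.< suc n
      m<n with m ℕ.<? suc n
      ... | yes m<n = m<n
      ... | no  m≮n = contradiction (∣approx⇒∣ {n = m} (ℕ.≮⇒≥ m≮n)
        (p^-weaken (ℕ.≮⇒≥ m≮n) (∣⇒∣approx {n = m} ℕ.≤-refl (proj₁ val)))) q≢1

      m∥d : m ∥ d
      m∥d = valuation⇒∥ m<n val

      ∈U⇒≤ : ∀ {j} → q ∈U j → j ℕ.≤ m
      ∈U⇒≤ {j} q∈Uⱼ with j ℕ.≤? m
      ... | yes j≤m = j≤m
      ... | no  j≰m = contradiction (∣approx⇒∣ {n = j} (ℕ.≰⇒> j≰m)
        (p^-weaken (ℕ.≰⇒> j≰m) (∣⇒∣approx {n = j} ℕ.≤-refl q∈Uⱼ))) (proj₂ val)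

      ≤⇒∈U : ∀ {j} → j ℕ.≤ m → q ∈U j
      ≤⇒∈U {j} j≤m = ∣approx⇒∣ {n = m} j≤m (p^-weaken j≤m (∣⇒∣approx {n = m} ℕ.≤-refl (proj₁ val)))

-- Cardinalities of the sets of modular fixed points.

module Cardinalities {p : ℕ} {{p-prime : Prime p}} where

  open import Data.Integer.Base using (ℤ; +_; _+_; _*_; _-_; -_; 1ℤ)
  open import Data.Integer.Divisibility.Signed
  open +-*-Solver
  open PrimePowers p-prime
  open IteratedSums using (pronic; iterated)
  open Counting
  open PAdic {p}

  count-ball : ∀ {a b n} → a ℕ.+ b ≡ n → ∀ r → Count (p ℕ.^ n) (λ k → p^ a ∣ + k - + r) (p ℕ.^ b)
  count-ball {a} {b} refl r = subst (λ m → Count m (λ k → p^ a ∣ + k - + r) (p ℕ.^ b))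
    (sym (ℕ.^-distribˡ-+-* p a b)) (count-class (p ℕ.^ a) (p ℕ.^ b) {{ℕ.m^n≢0 p a}} {{ℕ.m^n≢0 p b}} r)

  -- A congruence between k and l would force the centres x and y to agree modulo pʲ.
  balls-disjoint : ∀ {j n x y k l} → j ℕ.≤ n → ¬ p^ j ∣ x - y → p^ j ∣ + k - x → p^ j ∣ + l - y →
                   ¬ + k ≡ + l [mod p ℕ.^ n ]
  balls-disjoint {j} {n} {x} {y} {k} {l} j≤n p^j∤x-y k∈ l∈ (mod k≡l) = p^j∤x-y (subst (p^ j ∣_)
    (solve 4 (λ x y k l → (k :- l) :- ((k :- x) :- (l :- y)) := x :- y) refl x y (+ k) (+ l))
    (∣m∣n⇒∣m-n (p^-weaken j≤n k≡l) (∣m∣n⇒∣m-n k∈ l∈)))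

  p∤⇒p^1∤ : ∀ {x} → ¬ + p ∣ x → ¬ p^ 1 ∣ x
  p∤⇒p^1∤ p∤x e = p∤x (p^1∣⇒p∣ e)

  p∤-1 : ¬ + p ∣ + 0 - + 1
  p∤-1 p∣-1 = p∤1 (∣m⇒∣-m p∣-1)

  -- The factors k and k - 1 differ by a unit, so one of them carries all of p^(a+1). As the
  -- exponent is positive, the balls around 0 and 1 are disjoint.
  count-pronic : ∀ {a b n} → suc a ℕ.+ b ≡ n →
                 Count (p ℕ.^ n) (λ k → p^ (suc a) ∣ pronic (+ k)) (p ℕ.^ b ℕ.+ p ℕ.^ b)
  count-pronic {a} {b} {n} a+b≡n = count-⇔ to from
    (count-⊎ disjoint (count-ball {suc a} {b} a+b≡n 0) (count-ball {suc a} {b} a+b≡n 1))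
    where
    pronic≡ : ∀ k → (+ k - + 0) * (+ k - + 1) ≡ pronic (+ k)
    pronic≡ k = cong (_* (+ k - + 1)) (ℤ.+-identityʳ (+ k))

    to : ∀ k → p^ (suc a) ∣ + k - + 0 ⊎ p^ (suc a) ∣ + k - + 1 → p^ (suc a) ∣ pronic (+ k)
    to k (inj₁ e) = subst (p^ (suc a) ∣_) (pronic≡ k) (∣m⇒∣m*n (+ k - + 1) e)
    to k (inj₂ e) = ∣n⇒∣m*n (+ k) e

    from : ∀ k → p^ (suc a) ∣ pronic (+ k) → p^ (suc a) ∣ + k - + 0 ⊎ p^ (suc a) ∣ + k - + 1
    from k e = split-product (suc a) (p∤1 ∘ subst (+ p ∣_)
        (solve 1 (λ k → (k :- con (+ 0)) :- (k :- con (+ 1)) := con 1ℤ) refl (+ k)))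
      (subst (p^ (suc a) ∣_) (sym (pronic≡ k)) e)

    disjoint : ∀ {k l} → p^ (suc a) ∣ + k - + 0 → p^ (suc a) ∣ + l - + 1 → ¬ + k ≡ + l [mod p ℕ.^ n ]
    disjoint {k} {l} = balls-disjoint {suc a} {n} {+ 0} {+ 1} {k} {l}
      (ℕ.m+n≤o⇒m≤o (suc a) (ℕ.≤-reflexive a+b≡n))
      (p∤-1 ∘ p^suc∣⇒p∣ {a})

  module _ (q : ℤₚ p) (q∈U : q ∈U 1) (n : ℕ) (q≢1 : ¬ q D.≡ D.1# [mod-p^ suc n ])
           {m : ℕ} (val : HasValuation (q D.- D.1#) m) where

    open FixedPoints q q∈U n
    open GeometricDefect p-prime using (defect; HighOrder; defect-valuation; p^m≥5⇒high-order; p≡2⇒high-order;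
      p^[m+e]∣geomℤ-defect)

    m≤n : m ℕ.≤ n
    m≤n = ℕ.≤-pred (m<n {m} q≢1 val)

    1≤m : 1 ℕ.≤ m
    1≤m = ∈U⇒≤ {m} q≢1 val {1} q∈U

    -- Of the modulus p^(n+1) the factor d takes pᵐ, which leaves p^(e+1) to divide the sum.
    e : ℕ
    e = n ℕ.∸ m

    m+1+e≡1+n : m ℕ.+ suc e ≡ suc n
    m+1+e≡1+n = trans (ℕ.+-suc m e) (cong suc (ℕ.m+[n∸m]≡n m≤n))

    fixed⇒sum : ∀ k → Fixed k → p^ (suc e) ∣ iterated d 2 k
    fixed⇒sum k x = proj₁ (p^[m+e]∣geomℤ-defect d {m} (suc e) k (m∥d {m} q≢1 val))
      (subst (λ j → p^ j ∣ geomℤ (1ℤ + d) k - + k) (sym m+1+e≡1+n) x)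

    sum⇒fixed : ∀ k → p^ (suc e) ∣ iterated d 2 k → Fixed k
    sum⇒fixed k x = subst (λ j → p^ j ∣ geomℤ (1ℤ + d) k - + k) m+1+e≡1+n
      (proj₂ (p^[m+e]∣geomℤ-defect d {m} (suc e) k (m∥d {m} q≢1 val)) x)

    module _ (p∤2 : ¬ + p ∣ + 2) where

      fixed⇒defect : ∀ k → Fixed k → p^ (suc e) ∣ defect d k
      fixed⇒defect k x = ∣n⇒∣m*n (+ 2) (fixed⇒sum k x)

      defect⇒fixed : ∀ k → p^ (suc e) ∣ defect d k → Fixed k
      defect⇒fixed k x = sum⇒fixed k (unit-cancel (suc e) p∤2 x)

      odd-cardinality : 5 ℕ.≤ p ℕ.^ m → HasCardinality (ModularFixedPoints q q∈U (suc n)) (2 ℕ.* p ℕ.^ m)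
      odd-cardinality 5≤p^m = count⇒cardinality (subst (Count (p ℕ.^ suc n) Fixed)
        (cong (p ℕ.^ m ℕ.+_) (sym (ℕ.+-identityʳ (p ℕ.^ m))))
        (count-⇔ (λ k x → defect⇒fixed k (proj₂ (valuation k) x))
          (λ k x → proj₁ (valuation k) (fixed⇒defect k x))
          (count-pronic {e} {m} (trans (ℕ.+-comm (suc e) m) m+1+e≡1+n))))
        where
        valuation : ∀ k → (p^ (suc e) ∣ defect d k → p^ (suc e) ∣ pronic (+ k)) ×
                          (p^ (suc e) ∣ pronic (+ k) → p^ (suc e) ∣ defect d k)
        valuation k = defect-valuation d (p^m≥5⇒high-order d {m} (proj₁ (m∥d {m} q≢1 val)) 5≤p^m) k (suc e)

    -- The factor 2 in the defect raises the exponent by one, to e + 2. Each of the two balls then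
    -- has 2^(m-1) classes, in total 2ᵐ.
    even-cardinality : p ≡ 2 → HasCardinality (ModularFixedPoints q q∈U (suc n)) (p ℕ.^ m)
    even-cardinality p≡2 = count⇒cardinality (subst (Count (p ℕ.^ suc n) Fixed) (sym p^m≡)
        (count-⇔ (λ k x → sum⇒fixed k (∥-cancel {1} (suc e) 1∥2 (proj₂ (valuation k) x)))
          (λ k x → proj₁ (valuation k) (*-pres-p^∣ {1} {suc e} (proj₁ 1∥2) (fixed⇒sum k x)))
          (count-pronic {suc e} {ℕ.pred m} {suc n} exponents)))
      where
      m≡ : suc (ℕ.pred m) ≡ m
      m≡ = ℕ.suc-pred m {{ℕ.>-nonZero 1≤m}}

      exponents : suc (suc e) ℕ.+ ℕ.pred m ≡ suc n
      exponents = trans (ℕ.+-comm (suc (suc e)) (ℕ.pred m)) (trans (ℕ.+-suc (ℕ.pred m) (suc e))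
        (trans (cong (ℕ._+ suc e) m≡) m+1+e≡1+n))

      p^m≡ : p ℕ.^ m ≡ p ℕ.^ ℕ.pred m ℕ.+ p ℕ.^ ℕ.pred m
      p^m≡ = trans (cong (p ℕ.^_) (sym m≡)) (trans (cong (ℕ._* p ℕ.^ ℕ.pred m) p≡2)
        (cong (p ℕ.^ ℕ.pred m ℕ.+_) (ℕ.+-identityʳ (p ℕ.^ ℕ.pred m))))

      1∥2 : 1 ∥ + 2
      1∥2 = subst (λ x → + (x ℕ.^ 1) ∣ + 2 × ¬ + (x ℕ.^ 2) ∣ + 2) (sym p≡2)
        (∣-refl , λ x → ℕ.<⇒≱ (s≤s (s≤s (s≤s z≤n))) (ℕ.∣⇒≤ (∣⇒∣ᵤ x)))

      valuation : ∀ k → (p^ (suc (suc e)) ∣ defect d k → p^ (suc (suc e)) ∣ pronic (+ k)) ×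
                        (p^ (suc (suc e)) ∣ pronic (+ k) → p^ (suc (suc e)) ∣ defect d k)
      valuation k = defect-valuation d (p≡2⇒high-order d p≡2
        (p^1∣⇒p∣ (p^-weaken 1≤m (proj₁ (m∥d {m} q≢1 val))))) k (suc (suc e))

    module _ (p≡3 : p ≡ 3) (q∉U₂ : ¬ q ∈U 2) {v : ℕ}
             (smallest : IsSmallestNonzeroValuation q q∈U (suc n) v) where

      open ModuloThree p-prime p≡3 using (p∤2; critical-residue)

      m≡1 : m ≡ 1
      m≡1 with m ℕ.≤? 1
      ... | yes m≤1 = ℕ.≤-antisym m≤1 1≤m
      ... | no  m≰1 = contradiction (≤⇒∈U {m} q≢1 val {2} (ℕ.≰⇒> m≰1)) q∉U₂

      1≤n : 1 ℕ.≤ n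
      1≤n = ℕ.≤-trans 1≤m m≤n

      1+e≡n : suc e ≡ n
      1+e≡n = trans (cong (λ j → suc (n ℕ.∸ j)) m≡1) (ℕ.m+[n∸m]≡n 1≤n)

      1∥d : 1 ∥ d
      1∥d = subst (_∥ d) m≡1 (m∥d {m} q≢1 val)

      d-factor : ∃ λ u → d ≡ u * + p × ¬ + p ∣ u
      d-factor with proj₁ 1∥d
      ... | divides u d≡up^1 = u , d≡up , λ p∣u →
            proj₂ 1∥d (subst (p^ 2 ∣_) (sym d≡up) (p*-mono-∣ 1 u (p∣⇒p^1∣ p∣u)))
        where
        d≡up : d ≡ u * + p
        d≡up = trans d≡up^1 (cong (u *_) p^1)

      module Critical (u : ℤ) (d≡up : d ≡ u * + p) (p∤u : ¬ + p ∣ u) (r s : ℕ)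
        (pronic-factors : ∀ x → pronic x ≡ (x - + r) * (x - + s)) (p∤r-s : ¬ + p ∣ + r - + s)
        (p∣1+u[r-2] : + p ∣ 1ℤ + u * (+ r - + 2)) where

        open FirstOrderAtThree p-prime p≡3 u p∤u (+ r) (+ s) pronic-factors p∤r-s p∣1+u[r-2]
          using (module TwoRoots; module OneCluster; p^∣k-r⇒p^∣K)

        to-defect : ∀ k → Fixed k → p^ n ∣ defect (u * + p) k
        to-defect k x = subst₂ (λ j y → p^ j ∣ defect y k) 1+e≡n d≡up (fixed⇒defect p∤2 k x)

        from-defect : ∀ k → p^ n ∣ defect (u * + p) k → Fixed k
        from-defect k x = defect⇒fixed p∤2 k (subst₂ (λ j y → p^ j ∣ defect y k) (sym 1+e≡n) (sym d≡up) x)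

        -- Modulo p^(n+1) each ball of exponent n - v has p^(v+1) classes, and the ball of exponent
        -- n around s has p.
        two-roots-cardinality : 2 ℕ.* v ℕ.< n → (∃ λ l → Fixed l × v ∥ pronic (+ l)) →
          HasCardinality (ModularFixedPoints q q∈U (suc n)) ((p ℕ.^ suc v ℕ.+ p ℕ.^ suc v) ℕ.+ p ℕ.^ 1)
        two-roots-cardinality 2v<n (l , l-fixed , v∥Kl) =
          count⇒cardinality (count-⇔ (λ k x → from-defect k (from k x)) (λ k x → to k (to-defect k x))
          (count-⊎ s-apart
            (count-⊎ r-apart (count-ball {ε} {suc v} exponents r) (count-ball {ε} {suc v} exponents l))
            (count-ball {n} {1} (ℕ.+-comm n 1) s)))
          where
          open TwoRoots {n} {v} {l} (to-defect l l-fixed) v∥Kl 2v<n renaming (e to ε)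

          exponents : ε ℕ.+ suc v ≡ suc n
          exponents = trans (ℕ.+-suc ε v) (cong suc (trans (ℕ.+-comm ε v) v+e≡n))

          r-apart : ∀ {k k′} → p^ ε ∣ + k - + r → p^ ε ∣ + k′ - + l → ¬ + k ≡ + k′ [mod p ℕ.^ suc n ]
          r-apart {k} {k′} = balls-disjoint {ε} {suc n} {+ r} {+ l} {k} {k′} (ℕ.m≤n⇒m≤1+n (ℕ.m∸n≤m n v))
            λ x → ℕ.<⇒≱ v<e (∥-unique-≤ {v} {ε} v∥Kl (p^∣k-r⇒p^∣K {l} ε (subst (p^ ε ∣_)
              (solve 2 (λ r l → :- (r :- l) := l :- r) refl (+ r) (+ l)) (∣m⇒∣-m x))))

          1≤ε : 1 ℕ.≤ ε
          1≤ε = ℕ.≤-trans (s≤s z≤n) v<e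

          s-apart : ∀ {k k′} → p^ ε ∣ + k - + r ⊎ p^ ε ∣ + k - + l → p^ n ∣ + k′ - + s →
                    ¬ + k ≡ + k′ [mod p ℕ.^ suc n ]
          s-apart {k} {k′} near k′∈ = balls-disjoint {1} {suc n} {+ r} {+ s} {k} {k′} (s≤s z≤n) (p∤⇒p^1∤ p∤r-s)
            (p∣⇒p^1∣ (p∣k-r near)) (p^-weaken 1≤n k′∈)
            where
            p∣k-r : p^ ε ∣ + k - + r ⊎ p^ ε ∣ + k - + l → + p ∣ + k - + r
            p∣k-r (inj₁ x) = p^1∣⇒p∣ (p^-weaken 1≤ε x)
            p∣k-r (inj₂ x) = subst (+ p ∣_)
              (solve 3 (λ k l r → (k :- l) :+ (l :- r) := k :- r) refl (+ k) (+ l) (+ r))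
              (∣m∣n⇒∣m+n (p^1∣⇒p∣ (p^-weaken 1≤ε x)) p∣l-r)

        one-cluster-cardinality : n ℕ.≤ 2 ℕ.* v →
          HasCardinality (ModularFixedPoints q q∈U (suc n)) (p ℕ.^ (suc n ℕ.∸ ℕ.⌊ suc n /2⌋) ℕ.+ p ℕ.^ 1)
        one-cluster-cardinality n≤2v = count⇒cardinality
          (count-⇔ (λ k x → from-defect k (from k x)) (λ k x → to k (to-defect k x))
          (count-⊎ s-apart (count-ball {c} {suc n ℕ.∸ c} (ℕ.m+[n∸m]≡n c≤1+n) r) (count-ball {n} {1} (ℕ.+-comm n 1) s)))
          where
          -- This is n/2 rounded up, the least exponent with 2 c ≥ n.
          c : ℕ
          c = ℕ.⌊ suc n /2⌋

          c≤1+n : c ℕ.≤ suc n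
          c≤1+n = ℕ.⌊n/2⌋≤n (suc n)

          c≤v : c ℕ.≤ v
          c≤v = ℕ.≤-trans (ℕ.⌈n/2⌉-mono n≤2v)
            (ℕ.≤-reflexive (trans (cong (λ j → ℕ.⌈ v ℕ.+ j /2⌉) (ℕ.+-identityʳ v)) (sym (ℕ.n≡⌈n+n/2⌉ v))))

          n≤2c : n ℕ.≤ c ℕ.+ c
          n≤2c = ℕ.≤-trans (ℕ.≤-reflexive (sym (ℕ.⌊n/2⌋+⌈n/2⌉≡n n))) (ℕ.+-monoˡ-≤ c (ℕ.⌊n/2⌋≤⌈n/2⌉ n))

          -- The iteration starts at p + r, which is congruent to r and at least 2, so that K does
          -- not vanish there.
          open OneCluster {n} {c} {p ℕ.+ r} 1≤n n≤2c
            (ℕ.≤-trans (ℕ.nonTrivial⇒n>1 p {{ℕ.prime⇒nonTrivial p-prime}}) (ℕ.m≤m+n p r))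
            (∣-reflexive (solve 2 (λ p r → p := p :+ r :- r) refl (+ p) (+ r)))
            (λ {k} {a} x a∥K a≢0 → ℕ.≤-trans c≤v (smallest⇒minimal {v} smallest {k} {a} (from-defect k x) a∥K a≢0))

          s-apart : ∀ {k k′} → p^ c ∣ + k - + r → p^ n ∣ + k′ - + s → ¬ + k ≡ + k′ [mod p ℕ.^ suc n ]
          s-apart {k} {k′} x y = balls-disjoint {1} {suc n} {+ r} {+ s} {k} {k′} (s≤s z≤n) (p∤⇒p^1∤ p∤r-s)
            (p^-weaken (ℕ.⌊n/2⌋-mono {2} {suc n} (s≤s 1≤n)) x) (p^-weaken 1≤n y)

      two-roots-count : 2 ℕ.* v ℕ.< n →
        HasCardinality (ModularFixedPoints q q∈U (suc n)) ((p ℕ.^ suc v ℕ.+ p ℕ.^ suc v) ℕ.+ p ℕ.^ 1)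
      two-roots-count 2v<n =
        let u , d≡up , p∤u = d-factor
            r , s , factors , p∤r-s , p∣1+u[r-2] = critical-residue p∤u
        in Critical.two-roots-cardinality u d≡up p∤u r s factors p∤r-s p∣1+u[r-2] 2v<n
             (smallest⇒attained {v} (ℕ.m≤n⇒m≤1+n (ℕ.≤-<-trans (ℕ.m≤m+n v (v ℕ.+ 0)) 2v<n)) smallest)

      one-cluster-count : n ℕ.≤ 2 ℕ.* v →
        HasCardinality (ModularFixedPoints q q∈U (suc n)) (p ℕ.^ (suc n ℕ.∸ ℕ.⌊ suc n /2⌋) ℕ.+ p ℕ.^ 1)
      one-cluster-count =
        let u , d≡up , p∤u = d-factor
            r , s , factors , p∤r-s , p∣1+u[r-2] = critical-residue p∤u
        in Critical.one-cluster-cardinality u d≡up p∤u r s factors p∤r-s p∣1+u[r-2]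

-- Bounds for odd primes and assembly of the cases.

open import Data.Nat.Base using (ℕ; _+_; _*_; _∸_; _^_; _≤_; _<_; ⌊_/2⌋)
open import Data.Nat.Divisibility using (_∣_)
open import Data.Nat.Primality using (Prime)
open import Data.Product.Base using (_×_)
open import Data.Sum.Base using (_⊎_)
open import Relation.Binary.PropositionalEquality.Core using (_≡_; _≢_)
open import Relation.Nullary.Negation.Core using (¬_)
open import Defs using (ℤₚ; 1#; _-_; _∈U_; _≡_[mod-p^_]; HasValuation; HasCardinality; ModularFixedPoint; ModularFixedPoints; IsSmallestNonzeroValuation)

odd-prime≥3 : ∀ {p} → Prime p → ¬ (2 ∣ p) → 3 ≤ p
odd-prime≥3 {p} p-prime 2∤p = ℕ.≤∧≢⇒< (ℕ.nonTrivial⇒n>1 p {{ℕ.prime⇒nonTrivial p-prime}})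
  λ { refl → 2∤p ℕ.∣-refl }

odd-prime≢3⇒≥5 : ∀ {p} → Prime p → ¬ (2 ∣ p) → p ≢ 3 → 5 ≤ p
odd-prime≢3⇒≥5 p-prime 2∤p p≢3 = ℕ.≤∧≢⇒< (ℕ.≤∧≢⇒< (odd-prime≥3 p-prime 2∤p) (p≢3 ∘ sym))
  λ { refl → 2∤p (ℕ.divides 2 refl) }

corollary5p10 : (p : ℕ) {{p-prime : Prime p}} (q : ℤₚ p) (q∈U : q ∈U 1) (n : ℕ) → 1 ≤ n →
    (q ≡ 1# [mod-p^ n ] → ∀ z → ModularFixedPoint q q∈U n z)
    ×
    (¬ (q ≡ 1# [mod-p^ n ]) → ∀ m₀ → HasValuation (q - 1#) m₀ →
    (¬ (2 ∣ p) → (p ≢ 3 ⊎ q ∈U 2) →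
    HasCardinality (ModularFixedPoints q q∈U n) (2 * p ^ m₀))
    ×
    (p ≡ 2 →
    HasCardinality (ModularFixedPoints q q∈U n) (2 ^ m₀))
    ×
    (p ≡ 3 → ¬ (q ∈U 2) → ∀ v₀ → IsSmallestNonzeroValuation q q∈U n v₀ →
    (2 * v₀ < n ∸ 1 →
    HasCardinality (ModularFixedPoints q q∈U n) (2 * 3 ^ (v₀ + 1) + 3))
    ×
    (n ∸ 1 ≤ 2 * v₀ →
    HasCardinality (ModularFixedPoints q q∈U n) (3 ^ (n ∸ ⌊ n /2⌋) + 3))))
corollary5p10 p {{p-prime}} q q∈U (suc n) _ = FixedPoints.all-fixed q q∈U n , λ q≢1 m₀ val →
  (λ 2∤p regular → odd-cardinality q q∈U n q≢1 {m₀} val (p∤2 2∤p) (5≤p^m₀ q≢1 {m₀} val 2∤p regular)) ,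
  (λ p≡2 → subst (HasCardinality (ModularFixedPoints q q∈U (suc n))) (cong (_^ m₀) p≡2)
    (even-cardinality q q∈U n q≢1 {m₀} val p≡2)) ,
  λ p≡3 q∉U₂ v₀ smallest →
    (λ 2v₀<n → subst (HasCardinality (ModularFixedPoints q q∈U (suc n))) (two-roots-total v₀ p≡3)
      (two-roots-count q q∈U n q≢1 {m₀} val p≡3 q∉U₂ {v₀} smallest 2v₀<n)) ,
    (λ n≤2v₀ → subst (HasCardinality (ModularFixedPoints q q∈U (suc n)))
        (cong (λ b → b ^ (suc n ∸ ⌊ suc n /2⌋) + b ^ 1) p≡3)
      (one-cluster-count q q∈U n q≢1 {m₀} val p≡3 q∉U₂ {v₀} smallest n≤2v₀))
  where
  open PAdic {p}
  open Cardinalities {p}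

  p∤2 : ¬ (2 ∣ p) → ¬ (ℤ.+ p ℤ.∣ ℤ.+ 2)
  p∤2 2∤p p∣2 = ℕ.<⇒≱ (odd-prime≥3 p-prime 2∤p) (ℕ.∣⇒≤ (ℤ.∣⇒∣ᵤ p∣2))

  5≤p^m₀ : ¬ (q ≡ 1# [mod-p^ suc n ]) → ∀ {m₀} → HasValuation (q - 1#) m₀ →
           ¬ (2 ∣ p) → (p ≢ 3 ⊎ q ∈U 2) → 5 ≤ p ^ m₀
  5≤p^m₀ q≢1 {m₀} val 2∤p (inj₁ p≢3) = ℕ.≤-trans (odd-prime≢3⇒≥5 p-prime 2∤p p≢3)
    (ℕ.≤-trans (ℕ.≤-reflexive (sym (ℕ.*-identityʳ p)))
      (ℕ.^-monoʳ-≤ p {{ℕ.prime⇒nonZero p-prime}} (FixedPoints.∈U⇒≤ q q∈U n {m₀} q≢1 val {1} q∈U)))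
  -- Here m₀ ≥ 2, and p² ≥ 9 = 5 + 4.
  5≤p^m₀ q≢1 {m₀} val 2∤p (inj₂ q∈U₂) = ℕ.≤-trans (ℕ.m≤m+n 5 4)
    (ℕ.≤-trans (ℕ.^-monoˡ-≤ 2 (odd-prime≥3 p-prime 2∤p))
      (ℕ.^-monoʳ-≤ p {{ℕ.prime⇒nonZero p-prime}} (FixedPoints.∈U⇒≤ q q∈U n {m₀} q≢1 val {2} q∈U₂)))

  two-roots-total : ∀ v {b} → b ≡ 3 → (b ^ suc v + b ^ suc v) + b ^ 1 ≡ 2 * 3 ^ (v + 1) + 3
  two-roots-total v refl = cong (_+ 3) (trans (cong (3 ^ suc v +_) (sym (ℕ.+-identityʳ (3 ^ suc v))))
    (cong (λ j → 2 * 3 ^ j) (ℕ.+-comm 1 v)))
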